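{- For all integers $n,s\ge 1$, $\chi_{ltna}(C_{4n+2}\vee C_{2s+1})=5$.
   Context: All graphs are finite and simple. $C_k$ is the cycle on $k$ vertices. The join $G\vee H$ of (vertex-disjoint) graphs has $V(G\vee H)=V(G)\cup V(H)$ and $E(G\vee H)=E(G)\cup E(H)\cup\{uv\mid u\in V(G),v\in V(H)\}$. For a graph $G=(V,E)$ of order $p$ and size $q$ without isolated vertices, a bijection $f:V\cup E\to\{1,\dots,p+q\}$ is a local total neighborhood antimagic labeling of $G$ if the induced vertex coloring $f^+_{tn}(u)=\sum_{ux\in E}[f(ux)+f(x)]$ satisfies $f^+_{tn}(u)\ne f^+_{tn}(v)$ for every edge $uv\in E$. The number of distinct induced colors is $c_{tn}(f)$. The local total neighborhood antimagic chromatic number $\chi_{ltna}(G)$ is the minimum of $c_{tn}(f)$ over all local total neighborhood antimagic labelings $f$ of $G$; an assertion $\chi_{ltna}(G)=k$ includes the assertion that $G$ admits such a labeling. -}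

module Defs where

open import Algebra.Properties.CommutativeMonoid.Sum using (sum)
open import Data.Empty using (⊥-elim-irr)
open import Data.Fin using (Fin; toℕ; splitAt; _<_; _<?_)
open import Data.Fin.Properties using (<-cmp)
open import Data.List using (length; map; allFin; deduplicate)
open import Data.Nat using (ℕ; suc; _+_; _*_; _≤_; _≟_; s≤s)
open import Data.Nat.Properties
  using (+-0-commutativeMonoid; 1+n≢n; +-monoˡ-≤; *-monoʳ-≤; ≤-trans; m≤n+m)
open import Data.Product using (_×_; ∃-syntax; _,_)
open import Data.Sum using (_⊎_; inj₁; inj₂; swap; reduce)
open import Data.Unit using (⊤; tt)
open import Function.Bundles using (_⤖_; module Bijection)
open import Level using (0ℓ)
open import Relation.Binary using (Rel; Decidable; Symmetric; Irreflexive; tri<; tri≈; tri>)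
open import Relation.Binary.PropositionalEquality using (_≡_; _≢_; refl)
open import Relation.Nullary using (Dec; yes; no; ¬_)
open import Relation.Nullary.Decidable using (_×-dec_; _⊎-dec_)

∑ : ∀ {n} → (Fin n → ℕ) → ℕ
∑ = sum +-0-commutativeMonoid

record Graph : Set₁ where
  field
    order  : ℕ
    Adj    : Rel (Fin order) 0ℓ
    adj?   : Decidable Adj
    symm   : Symmetric Adj
    irrefl : Irreflexive _≡_ Adj

  Vertex : Set
  Vertex = Fin order

  -- An unordered edge is stored once, with its smaller end first.  The proofs
  -- are irrelevant, so edges with the same ends are equal.
  record Edge : Set where
    constructor mkEdge
    field
      lo hi     : Vertex
      .lo<hi    : lo < hi
      .adjacent : Adj lo hi

  edge : (u v : Vertex) → .(Adj u v) → Edge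
  edge u v a with <-cmp u v
  ... | tri< u<v _ _ = mkEdge u v u<v a
  ... | tri≈ _ u≡v _ = ⊥-elim-irr (irrefl u≡v a)
  ... | tri> _ _ v<u = mkEdge v u v<u (symm a)

  indicator : ∀ {P : Set} → Dec P → ℕ
  indicator (yes _) = 1
  indicator (no _)  = 0

  size : ℕ
  size = ∑ λ u → ∑ λ v → indicator ((u <? v) ×-dec adj? u v)

  NoIsolatedVertices : Set
  NoIsolatedVertices = ∀ u → ∃[ v ] Adj u v

open Graph public
  using (order; Adj; adj?; symm; irrefl; Vertex; Edge; edge; size; NoIsolatedVertices)

module _ {k : ℕ} where

  Next : Rel (Fin k) 0ℓ
  Next u v = suc (toℕ u) ≡ toℕ v ⊎ (suc (toℕ u) ≡ k × toℕ v ≡ 0)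

  next? : Decidable Next
  next? u v = (suc (toℕ u) ≟ toℕ v) ⊎-dec ((suc (toℕ u) ≟ k) ×-dec (toℕ v ≟ 0))

  next-irrefl : 3 ≤ k → ∀ {u} → ¬ Next u u
  next-irrefl _   (inj₁ e)           = 1+n≢n e
  next-irrefl 3≤k {u} (inj₂ (e , z)) with toℕ u
  next-irrefl (s≤s ()) (inj₂ (refl , refl)) | 0

cycle : (k : ℕ) → 3 ≤ k → Graph
cycle k 3≤k = record
  { order  = k
  ; Adj    = λ u v → Next u v ⊎ Next v u
  ; adj?   = λ u v → next? u v ⊎-dec next? v u
  ; symm   = swap
  ; irrefl = λ { refl a → next-irrefl 3≤k (reduce a) }
  }

infixr 6 _∨_

module _ (G H : Graph) where

  JoinAdj : Rel (Vertex G ⊎ Vertex H) 0ℓ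
  JoinAdj (inj₁ u) (inj₁ v) = Adj G u v
  JoinAdj (inj₂ u) (inj₂ v) = Adj H u v
  JoinAdj (inj₁ _) (inj₂ _) = ⊤
  JoinAdj (inj₂ _) (inj₁ _) = ⊤

  joinAdj? : Decidable JoinAdj
  joinAdj? (inj₁ u) (inj₁ v) = adj? G u v
  joinAdj? (inj₂ u) (inj₂ v) = adj? H u v
  joinAdj? (inj₁ _) (inj₂ _) = yes tt
  joinAdj? (inj₂ _) (inj₁ _) = yes tt

  joinAdj-sym : ∀ x y → JoinAdj x y → JoinAdj y x
  joinAdj-sym (inj₁ u) (inj₁ v) = symm G
  joinAdj-sym (inj₂ u) (inj₂ v) = symm H
  joinAdj-sym (inj₁ _) (inj₂ _) = λ _ → tt
  joinAdj-sym (inj₂ _) (inj₁ _) = λ _ → tt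

  joinAdj-irrefl : ∀ x → ¬ JoinAdj x x
  joinAdj-irrefl (inj₁ u) = irrefl G refl
  joinAdj-irrefl (inj₂ u) = irrefl H refl

_∨_ : Graph → Graph → Graph
G ∨ H = record
  { order  = order G + order H
  ; Adj    = λ u v → JoinAdj G H (split u) (split v)
  ; adj?   = λ u v → joinAdj? G H (split u) (split v)
  ; symm   = λ {u} {v} → joinAdj-sym G H (split u) (split v)
  ; irrefl = λ { {u} refl → joinAdj-irrefl G H (split u) }
  }
  where
  split : Fin (order G + order H) → Vertex G ⊎ Vertex H
  split = splitAt (order G)

module _ (G : Graph) where

  -- The label set {1, …, p + q} is Fin (p + q) shifted by one; see label.
  TotalLabeling : Set
  TotalLabeling = (Vertex G ⊎ Edge G) ⤖ Fin (order G + size G)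

module _ {G : Graph} (f : TotalLabeling G) where

  label : Vertex G ⊎ Edge G → ℕ
  label x = suc (toℕ (Bijection.to f x))

  contribution : (u x : Vertex G) → Dec (Adj G u x) → ℕ
  contribution u x (yes a) = label (inj₂ (edge G u x a)) + label (inj₁ x)
  contribution u x (no _)  = 0

  inducedColor : Vertex G → ℕ
  inducedColor u = ∑ λ x → contribution u x (adj? G u x)

  IsLocalTotalNeighborhoodAntimagic : Set
  IsLocalTotalNeighborhoodAntimagic =
    ∀ u v → Adj G u v → inducedColor u ≢ inducedColor v

  numberOfColors : ℕ
  numberOfColors = length (deduplicate _≟_ (map inducedColor (allFin (order G))))

-- A relation rather than a function, since a graph need not admit a labeling.
record χltna_is_ (G : Graph) (k : ℕ) : Set where
  field
    noIsolated : NoIsolatedVertices G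
    attained   : ∃[ f ] IsLocalTotalNeighborhoodAntimagic {G} f × numberOfColors f ≡ k
    minimal    : ∀ f → IsLocalTotalNeighborhoodAntimagic {G} f → k ≤ numberOfColors f

3≤4n+2 : ∀ {n} → 1 ≤ n → 3 ≤ 4 * n + 2
3≤4n+2 1≤n = ≤-trans (m≤n+m 3 3) (+-monoˡ-≤ 2 (*-monoʳ-≤ 4 1≤n))

3≤2s+1 : ∀ {s} → 1 ≤ s → 3 ≤ 2 * s + 1
3≤2s+1 1≤s = +-monoˡ-≤ 1 (*-monoʳ-≤ 2 1≤s)

-- Every colouring of C_m ∨ C_k with m even and k odd uses 2 + 3 colours, so it
-- suffices to find a labeling with five colours.  Write m = 2h, h = 2n + 1,
-- k = 2s + 1.  The zigzag z with z(2r) = n + r, z(2r + 1) = r permutes Z_h, and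
-- z(t) + z(t + 1) = n + t holds cyclically because h is odd.  On C_m the even
-- vertices are labelled by z and the odd ones by the reflection of z, the edges
-- and one column of the array of join edges by arithmetic progressions that make
-- the linear terms cancel.  On C_k the vertices are labelled by the zigzag and
-- each edge j, j + 1 by the reflection of the label of j, so that only the
-- difference z(j + 1) - z(j) matters, which takes two values.  The other 2s
-- columns of the array are paired so that each row splits into pairs of constant
-- sum; the column sums then depend on the parity of the column only.  The two
-- groups of colours are kept apart by size: those of C_m are the smaller ones
-- for s < h and the larger ones for s ≥ h.
module Submission where

open import Defs
open import Algebra.Properties.CommutativeMonoid.Sum using (sum-remove)
open import Algebra.Properties.Monoid.Sum using (sum-cong-≗; sum-replicate-zero)
open import Data.Empty using (⊥-elim; ⊥-elim-irr)
open import Data.Fin as Fin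
  using (Fin; toℕ; fromℕ; fromℕ<; splitAt; punchIn; punchOut; _↑ˡ_; _↑ʳ_)
open import Data.Fin.Permutation using (↔⇒≡)
open import Data.Fin.Properties as Finₚ
  using ( toℕ-fromℕ<; toℕ-fromℕ; toℕ-injective; toℕ<n; fromℕ<-injective; fromℕ<-toℕ; <-cmp
        ; splitAt-↑ˡ; splitAt-↑ʳ; splitAt⁻¹-↑ˡ; splitAt⁻¹-↑ʳ; toℕ-↑ˡ; toℕ-↑ʳ; ↑ˡ-injective; ↑ʳ-injective
        ; any?; punchOut-injective; punchInᵢ≢i; punchIn-punchOut; injective⇒≤; +↔⊎; *↔×)
open import Data.List using (List; []; _∷_; length; lookup; allFin; deduplicate)
import Data.List as List
open import Data.List.Membership.Propositional using (_∈_)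
open import Data.List.Membership.Propositional.Properties
  using (∈-lookup; ∈-map⁺; ∈-map⁻; ∈-allFin; ∈-deduplicate⁺; ∈-deduplicate⁻)
open import Data.List.Relation.Binary.Subset.Propositional using (_⊆_)
open import Data.List.Relation.Unary.All as All using ([]; _∷_)
open import Data.List.Relation.Unary.AllPairs using ([]; _∷_)
open import Data.List.Relation.Unary.Any using (here; there; index)
open import Data.List.Relation.Unary.Any.Properties using (lookup-index)
open import Data.List.Relation.Unary.Unique.DecPropositional.Properties using (deduplicate-!)
open import Data.List.Relation.Unary.Unique.Propositional using (Unique)
open import Data.Nat hiding (<-cmp)
open import Data.Nat.Properties as ℕₚ hiding (<-cmp)
open import Data.Nat.Tactic.RingSolver using (solve-∀)
open import Data.Product using (Σ; ∃; ∃-syntax; _×_; _,_; proj₁; proj₂)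
import Data.Product as Product
open import Data.Product.Function.Dependent.Propositional using () renaming (cong to Σ-cong)
open import Data.Sum as Sum using (_⊎_; inj₁; inj₂; [_,_]′)
open import Data.Sum.Function.Propositional using (_⊎-↔_)
open import Data.Sum.Properties using (swap-↔)
open import Data.Unit using (tt)
open import Function
open import Function.Consequences.Propositional using (strictlySurjective⇒surjective)
open import Function.Construct.Composition using (_↔-∘_)
open import Function.Construct.Identity using (↔-id)
open import Function.Construct.Symmetry using (↔-sym)
open import Function.Properties.Inverse using (↔⇒↣)
open import Relation.Binary using (tri<; tri≈; tri>)
open import Relation.Binary.PropositionalEquality hiding (J)
open import Relation.Nullary
open import Relation.Nullary.Decidable using (recompute; _×-dec_; ¬?)

-- Total labelings from injective codes

injective⇒surjective : ∀ {n} {f : Fin n → Fin n} → Injective _≡_ _≡_ f → ∀ y → ∃[ x ] f x ≡ y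
injective⇒surjective {suc n} {f} inj y with any? (λ x → f x Fin.≟ y)
... | yes hit = hit
... | no miss = contradiction (injective⇒≤ {f = g} g-inj) 1+n≰n
  where
  y≢f : ∀ x → y ≢ f x
  y≢f x y≡fx = miss (x , sym y≡fx)
  g : Fin (suc n) → Fin n
  g x = punchOut (y≢f x)
  g-inj : Injective _≡_ _≡_ g
  g-inj {x} {z} = inj ∘ punchOut-injective (y≢f x) (y≢f z)

-- Applied twice, this turns the double sum of indicators that defines `size` into a type of marked
-- pairs of vertices.
Fin-∑↔Σ : ∀ {n} (f : Fin n → ℕ) → Fin (∑ f) ↔ Σ (Fin n) (Fin ∘ f)
Fin-∑↔Σ {zero}  f = mk↔ₛ′ (λ ()) (λ ()) (λ ()) (λ ())
Fin-∑↔Σ {suc n} f = unfold ↔-∘ ((↔-id _ ⊎-↔ Fin-∑↔Σ (f ∘ Fin.suc)) ↔-∘ +↔⊎)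
  where
  unfold : (Fin (f Fin.zero) ⊎ Σ (Fin n) (Fin ∘ f ∘ Fin.suc)) ↔ Σ (Fin (suc n)) (Fin ∘ f)
  unfold = mk↔ₛ′
    (λ { (inj₁ x) → Fin.zero , x ; (inj₂ (i , x)) → Fin.suc i , x })
    (λ { (Fin.zero , x) → inj₁ x ; (Fin.suc i , x) → inj₂ (i , x) })
    (λ { (Fin.zero , x) → refl ; (Fin.suc i , x) → refl })
    (λ { (inj₁ x) → refl ; (inj₂ (i , x)) → refl })

module _ (G : Graph) where

  open Graph G using (indicator)

  private
    -- The proof is taken irrelevantly because an edge keeps only irrelevant proofs of `lo < hi` and
    -- of adjacency.
    mark : ∀ {P : Set} (d : Dec P) → .P → Fin (indicator d)
    mark (yes _) _ = Fin.zero
    mark (no ¬p) p = ⊥-elim-irr (¬p p)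

    marked : ∀ {P : Set} (d : Dec P) → Fin (indicator d) → P
    marked (yes p) _ = p

    mark-unique : ∀ {P : Set} (d : Dec P) (x y : Fin (indicator d)) → x ≡ y
    mark-unique (yes _) Fin.zero Fin.zero = refl

  Edge↔Fin-size : Edge G ↔ Fin (size G)
  Edge↔Fin-size = ↔-sym
    (pairs ↔-∘ (Σ-cong (↔-id _) (λ {u} → Fin-∑↔Σ (λ v → indicator (d u v))) ↔-∘ Fin-∑↔Σ _))
    where
    d : ∀ u v → Dec (u Fin.< v × Adj G u v)
    d u v = (u Fin.<? v) ×-dec adj? G u v
    pairs : (Σ (Vertex G) λ u → Σ (Vertex G) λ v → Fin (indicator (d u v))) ↔ Edge G
    pairs = mk↔ₛ′
      (λ { (u , v , x) → Graph.mkEdge u v (proj₁ (marked (d u v) x)) (proj₂ (marked (d u v) x)) })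
      (λ { (Graph.mkEdge u v u<v a) → u , v , mark (d u v) (u<v , a) })
      (λ { (Graph.mkEdge u v u<v a) → refl })
      (λ { (u , v , x) → cong (λ y → u , v , y) (mark-unique (d u v) _ _) })

  module _ (code : Vertex G ⊎ Edge G → ℕ)
           (code< : ∀ x → code x < order G + size G)
           (code-inj : ∀ {x y} → code x ≡ code y → x ≡ y) where

    -- Vertices and edges together number `order G + size G` by `Edge↔Fin-size`, so an injective
    -- code below that bound is onto by counting.
    fromCode : TotalLabeling G
    fromCode = mk⤖ (to-inj , strictlySurjective⇒surjective to-surj)
      where
      to : Vertex G ⊎ Edge G → Fin (order G + size G)
      to x = fromℕ< (code< x)
      to-inj : Injective _≡_ _≡_ to
      to-inj {x} {y} e = code-inj (fromℕ<-injective _ _ (code< x) (code< y) e)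
      items : Fin (order G + size G) ↔ (Vertex G ⊎ Edge G)
      items = (↔-id _ ⊎-↔ ↔-sym Edge↔Fin-size) ↔-∘ +↔⊎
      to-surj : ∀ y → ∃[ x ] to x ≡ y
      to-surj y = Product.map (Inverse.to items) id
        (injective⇒surjective {f = to ∘ Inverse.to items} (Injection.injective (↔⇒↣ items) ∘ to-inj) y)

    label-fromCode : ∀ x → label {G} fromCode x ≡ suc (code x)
    label-fromCode x = cong suc (toℕ-fromℕ< (code< x))

-- Edges of cycles and joins

module _ (G : Graph) where

  edge-< : ∀ {u v} .(u<v : u Fin.< v) .(a : Adj G u v) → edge G u v a ≡ Graph.mkEdge u v u<v a
  edge-< {u} {v} u<v a with <-cmp u v
  ... | tri< _ _ _ = refl
  ... | tri≈ u≮v _ _ = ⊥-elim-irr (u≮v u<v)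
  ... | tri> u≮v _ _ = ⊥-elim-irr (u≮v u<v)

  edge-> : ∀ {u v} .(v<u : v Fin.< u) .(a : Adj G u v) → edge G u v a ≡ Graph.mkEdge v u v<u (symm G a)
  edge-> {u} {v} v<u a with <-cmp u v
  ... | tri< _ _ v≮u = ⊥-elim-irr (v≮u v<u)
  ... | tri≈ _ _ v≮u = ⊥-elim-irr (v≮u v<u)
  ... | tri> _ _ _ = refl

  edge-sym : ∀ u v .(a : Adj G u v) → edge G u v a ≡ edge G v u (symm G a)
  edge-sym u v a with <-cmp u v
  ... | tri< u<v _ _ = sym (edge-> u<v (symm G a))
  ... | tri≈ _ u≡v _ = ⊥-elim-irr (irrefl G u≡v a)
  ... | tri> _ _ v<u = sym (edge-< v<u (symm G a))

module _ {k : ℕ} where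

  next-uniqueʳ : {u v w : Fin k} → Next u v → Next u w → v ≡ w
  next-uniqueʳ (inj₁ p) (inj₁ q) = toℕ-injective (trans (sym p) q)
  next-uniqueʳ {v = v} (inj₁ p) (inj₂ (q , _)) = contradiction (trans (sym p) q) (<⇒≢ (toℕ<n v))
  next-uniqueʳ {w = w} (inj₂ (p , _)) (inj₁ q) = contradiction (trans (sym q) p) (<⇒≢ (toℕ<n w))
  next-uniqueʳ (inj₂ (_ , p)) (inj₂ (_ , q)) = toℕ-injective (trans p (sym q))

  next-uniqueˡ : {u v w : Fin k} → Next v u → Next w u → v ≡ w
  next-uniqueˡ (inj₁ p) (inj₁ q) = toℕ-injective (suc-injective (trans p (sym q)))
  next-uniqueˡ (inj₁ p) (inj₂ (_ , q)) = contradiction (trans p q) 1+n≢0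
  next-uniqueˡ (inj₂ (_ , p)) (inj₁ q) = contradiction (trans q p) 1+n≢0
  next-uniqueˡ (inj₂ (p , _)) (inj₂ (q , _)) = toℕ-injective (suc-injective (trans p (sym q)))

  -- Two vertices that succeed each other would close a cycle of length at most 2.
  next-asym : 3 ≤ k → {u v : Fin k} → Next u v → ¬ Next v u
  next-asym _ (inj₁ p) (inj₁ q) = <-irrefl refl (<-trans (≤-reflexive p) (≤-reflexive q))
  next-asym 3≤k (inj₁ p) (inj₂ (q , z)) = contradiction
    (subst (3 ≤_) (trans (sym q) (cong suc (trans (sym p) (cong suc z)))) 3≤k) λ { (s≤s (s≤s ())) }
  next-asym 3≤k (inj₂ (q , z)) (inj₁ p) = contradiction
    (subst (3 ≤_) (trans (sym q) (cong suc (trans (sym p) (cong suc z)))) 3≤k) λ { (s≤s (s≤s ())) }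
  next-asym 3≤k (inj₂ (p , _)) (inj₂ (_ , z)) = contradiction
    (subst (3 ≤_) (trans (sym p) (cong suc z)) 3≤k) λ { (s≤s ()) }

next : ∀ {k} (u : Fin k) → ∃ (Next u)
next {suc k} u with suc (toℕ u) <? suc k
... | yes p = fromℕ< p , inj₁ (sym (toℕ-fromℕ< p))
... | no ¬p = Fin.zero , inj₂ (≤-antisym (toℕ<n u) (≮⇒≥ ¬p) , refl)

module _ {k : ℕ} (3≤k : 3 ≤ k) where

  private C = cycle k 3≤k

  -- Edges are stored by size of their ends, not by orientation. For the edge across the seam,
  -- between `k - 1` and `0`, the end that precedes the other is `hi`; for every other edge it is
  -- `lo`.
  tail : Edge C → Fin k
  tail (Graph.mkEdge lo hi _ _) with next? lo hi
  ... | yes _ = lo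
  ... | no _  = hi

  cycleEdge : Fin k → Edge C
  cycleEdge i = edge C i (proj₁ (next i)) (inj₁ (proj₂ (next i)))

  cycleEdge≡ : ∀ {i j} (nxt : Next i j) → edge C i j (inj₁ nxt) ≡ cycleEdge i
  cycleEdge≡ {i} nxt with refl ← next-uniqueʳ nxt (proj₂ (next i)) = refl

  tail-cycleEdge : ∀ i → tail (cycleEdge i) ≡ i
  tail-cycleEdge i with next i
  ... | j , nxt with <-cmp i j
  ...   | tri≈ _ i≡j _ = ⊥-elim (irrefl C i≡j (inj₁ nxt))
  ...   | tri< _ _ _ with next? i j
  ...     | yes _ = refl
  ...     | no ¬p = contradiction nxt ¬p
  tail-cycleEdge i | j , nxt | tri> _ _ _ with next? j i
  ...     | yes p = contradiction p (next-asym 3≤k nxt)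
  ...     | no _ = refl

  cycleEdge-tail : ∀ e → cycleEdge (tail e) ≡ e
  cycleEdge-tail (Graph.mkEdge lo hi lo<hi a) with next? lo hi
  ... | yes p = trans (sym (cycleEdge≡ p)) (edge-< C lo<hi (inj₁ p))
  ... | no ¬p = trans (sym (cycleEdge≡ nxt)) (edge-> C lo<hi (inj₁ nxt))
    where
    nxt : Next hi lo
    -- The stored adjacency proof is irrelevant; deciding adjacency anew yields one that can be
    -- analysed.
    nxt = [ (λ p → contradiction p ¬p) , id ]′ (recompute (adj? C lo hi) a)

  Edge-cycle↔Fin : Edge C ↔ Fin k
  Edge-cycle↔Fin = mk↔ₛ′ tail cycleEdge tail-cycleEdge cycleEdge-tail

data Side (m k : ℕ) : Fin (m + k) → Set where
  left  : ∀ i → Side m k (i ↑ˡ k)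
  right : ∀ j → Side m k (m ↑ʳ j)

side : ∀ m k x → Side m k x
side m k x with splitAt m x in eq
... | inj₁ i = subst (Side m k) (splitAt⁻¹-↑ˡ eq) (left i)
... | inj₂ j = subst (Side m k) (splitAt⁻¹-↑ʳ eq) (right j)

module _ (G H : Graph) where

  private
    m = order G
    k = order H

  adjˡˡ : ∀ {u v} → Adj G u v → Adj (G ∨ H) (u ↑ˡ k) (v ↑ˡ k)
  adjˡˡ {u} {v} a rewrite splitAt-↑ˡ m u k | splitAt-↑ˡ m v k = a

  adjʳʳ : ∀ {u v} → Adj H u v → Adj (G ∨ H) (m ↑ʳ u) (m ↑ʳ v)
  adjʳʳ {u} {v} a rewrite splitAt-↑ʳ m k u | splitAt-↑ʳ m k v = a

  adjˡʳ : ∀ u v → Adj (G ∨ H) (u ↑ˡ k) (m ↑ʳ v)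
  adjˡʳ u v rewrite splitAt-↑ˡ m u k | splitAt-↑ʳ m k v = tt

  adjˡˡ⁻¹ : ∀ {u v} → Adj (G ∨ H) (u ↑ˡ k) (v ↑ˡ k) → Adj G u v
  adjˡˡ⁻¹ {u} {v} a rewrite splitAt-↑ˡ m u k | splitAt-↑ˡ m v k = a

  adjʳʳ⁻¹ : ∀ {u v} → Adj (G ∨ H) (m ↑ʳ u) (m ↑ʳ v) → Adj H u v
  adjʳʳ⁻¹ {u} {v} a rewrite splitAt-↑ʳ m k u | splitAt-↑ʳ m k v = a

  ↑ˡ-mono-< : {u v : Fin m} → u Fin.< v → u ↑ˡ k Fin.< v ↑ˡ k
  ↑ˡ-mono-< {u} {v} = subst₂ _<_ (sym (toℕ-↑ˡ u k)) (sym (toℕ-↑ˡ v k))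

  ↑ˡ-cancel-< : {u v : Fin m} → u ↑ˡ k Fin.< v ↑ˡ k → u Fin.< v
  ↑ˡ-cancel-< {u} {v} = subst₂ _<_ (toℕ-↑ˡ u k) (toℕ-↑ˡ v k)

  ↑ʳ-mono-< : {u v : Fin k} → u Fin.< v → m ↑ʳ u Fin.< m ↑ʳ v
  ↑ʳ-mono-< {u} {v} = subst₂ _<_ (sym (toℕ-↑ʳ m u)) (sym (toℕ-↑ʳ m v)) ∘ +-monoʳ-< m

  ↑ʳ-cancel-< : {u v : Fin k} → m ↑ʳ u Fin.< m ↑ʳ v → u Fin.< v
  ↑ʳ-cancel-< {u} {v} = +-cancelˡ-< m _ _ ∘ subst₂ _<_ (toℕ-↑ʳ m u) (toℕ-↑ʳ m v)

  ↑ˡ<↑ʳ : ∀ (u : Fin m) (v : Fin k) → u ↑ˡ k Fin.< m ↑ʳ v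
  ↑ˡ<↑ʳ u v = subst₂ _<_ (sym (toℕ-↑ˡ u k)) (sym (toℕ-↑ʳ m v)) (<-≤-trans (toℕ<n u) (m≤m+n m _))

  JoinEdge : Set
  JoinEdge = (Edge G ⊎ Edge H) ⊎ (Fin m × Fin k)

  fromJoinEdge : JoinEdge → Edge (G ∨ H)
  fromJoinEdge (inj₁ (inj₁ (Graph.mkEdge u v u<v a))) = Graph.mkEdge (u ↑ˡ k) (v ↑ˡ k) (↑ˡ-mono-< u<v) (adjˡˡ a)
  fromJoinEdge (inj₁ (inj₂ (Graph.mkEdge u v u<v a))) = Graph.mkEdge (m ↑ʳ u) (m ↑ʳ v) (↑ʳ-mono-< u<v) (adjʳʳ a)
  fromJoinEdge (inj₂ (u , v)) = Graph.mkEdge (u ↑ˡ k) (m ↑ʳ v) (↑ˡ<↑ʳ u v) (adjˡʳ u v)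

  ↑ˡ≢↑ʳ : ∀ (u : Fin m) (v : Fin k) → u ↑ˡ k ≢ m ↑ʳ v
  ↑ˡ≢↑ʳ u v e = <⇒≢ (↑ˡ<↑ʳ u v) (cong toℕ e)

  fromJoinEdge-injective : ∀ {x y} → fromJoinEdge x ≡ fromJoinEdge y → x ≡ y
  fromJoinEdge-injective {x} {y} e with x | y | cong Graph.Edge.lo e | cong Graph.Edge.hi e
  ... | inj₁ (inj₁ _) | inj₁ (inj₁ _) | p | q
    with refl ← ↑ˡ-injective k _ _ p | refl ← ↑ˡ-injective k _ _ q = refl
  ... | inj₁ (inj₂ _) | inj₁ (inj₂ _) | p | q
    with refl ← ↑ʳ-injective m _ _ p | refl ← ↑ʳ-injective m _ _ q = refl
  ... | inj₂ _ | inj₂ _ | p | q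
    with refl ← ↑ˡ-injective k _ _ p | refl ← ↑ʳ-injective m _ _ q = refl
  ... | inj₁ (inj₁ _) | inj₁ (inj₂ _) | p | _ = contradiction p (↑ˡ≢↑ʳ _ _)
  ... | inj₁ (inj₂ _) | inj₁ (inj₁ _) | p | _ = contradiction (sym p) (↑ˡ≢↑ʳ _ _)
  ... | inj₁ (inj₁ _) | inj₂ _ | _ | q = contradiction q (↑ˡ≢↑ʳ _ _)
  ... | inj₂ _ | inj₁ (inj₁ _) | _ | q = contradiction (sym q) (↑ˡ≢↑ʳ _ _)
  ... | inj₁ (inj₂ _) | inj₂ _ | p | _ = contradiction (sym p) (↑ˡ≢↑ʳ _ _)
  ... | inj₂ _ | inj₁ (inj₂ _) | p | _ = contradiction p (↑ˡ≢↑ʳ _ _)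

  fromJoinEdge-surjective : ∀ e → ∃[ x ] fromJoinEdge x ≡ e
  fromJoinEdge-surjective (Graph.mkEdge lo hi lo<hi a) with side m k lo | side m k hi
  ... | left u | left v = inj₁ (inj₁ (Graph.mkEdge u v (↑ˡ-cancel-< lo<hi) (adjˡˡ⁻¹ a))) , refl
  ... | right u | right v = inj₁ (inj₂ (Graph.mkEdge u v (↑ʳ-cancel-< lo<hi) (adjʳʳ⁻¹ a))) , refl
  ... | left u | right v = inj₂ (u , v) , refl
  ... | right u | left v = ⊥-elim-irr (Finₚ.<-asym lo<hi (↑ˡ<↑ʳ v u))

  JoinEdge↔Edge : JoinEdge ↔ Edge (G ∨ H)
  JoinEdge↔Edge = mk↔ₛ′ fromJoinEdge (proj₁ ∘ fromJoinEdge-surjective)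
    (proj₂ ∘ fromJoinEdge-surjective)
    (λ x → fromJoinEdge-injective (proj₂ (fromJoinEdge-surjective (fromJoinEdge x))))

  fromJoinEdge-ˡˡ : ∀ u v (a : Adj G u v) →
    fromJoinEdge (inj₁ (inj₁ (edge G u v a))) ≡ edge (G ∨ H) (u ↑ˡ k) (v ↑ˡ k) (adjˡˡ a)
  fromJoinEdge-ˡˡ u v a with <-cmp u v
  ... | tri< u<v _ _ = sym (edge-< (G ∨ H) (↑ˡ-mono-< u<v) (adjˡˡ a))
  ... | tri≈ _ u≡v _ = contradiction a (irrefl G u≡v)
  ... | tri> _ _ v<u = sym (edge-> (G ∨ H) (↑ˡ-mono-< v<u) (adjˡˡ a))

  fromJoinEdge-ʳʳ : ∀ u v (a : Adj H u v) →
    fromJoinEdge (inj₁ (inj₂ (edge H u v a))) ≡ edge (G ∨ H) (m ↑ʳ u) (m ↑ʳ v) (adjʳʳ a)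
  fromJoinEdge-ʳʳ u v a with <-cmp u v
  ... | tri< u<v _ _ = sym (edge-< (G ∨ H) (↑ʳ-mono-< u<v) (adjʳʳ a))
  ... | tri≈ _ u≡v _ = contradiction a (irrefl H u≡v)
  ... | tri> _ _ v<u = sym (edge-> (G ∨ H) (↑ʳ-mono-< v<u) (adjʳʳ a))

  fromJoinEdge-ˡʳ : ∀ u v → fromJoinEdge (inj₂ (u , v)) ≡ edge (G ∨ H) (u ↑ˡ k) (m ↑ʳ v) (adjˡʳ u v)
  fromJoinEdge-ˡʳ u v = sym (edge-< (G ∨ H) (↑ˡ<↑ʳ u v) (adjˡʳ u v))

-- Counting colours

module _ {A : Set} where

  lookup-injective : {xs : List A} → Unique xs → ∀ {i j} → lookup xs i ≡ lookup xs j → i ≡ j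
  lookup-injective (_ ∷ _)  {Fin.zero}  {Fin.zero}  _ = refl
  lookup-injective (x≢ ∷ _) {Fin.zero}  {Fin.suc j} e = contradiction e (All.lookup x≢ (∈-lookup j))
  lookup-injective (x≢ ∷ _) {Fin.suc i} {Fin.zero}  e = contradiction (sym e) (All.lookup x≢ (∈-lookup i))
  lookup-injective (_ ∷ u)  {Fin.suc i} {Fin.suc j} e = cong Fin.suc (lookup-injective u e)

  unique-⊆⇒length≤ : {xs ys : List A} → Unique xs → xs ⊆ ys → length xs ≤ length ys
  unique-⊆⇒length≤ {xs} {ys} u xs⊆ys = injective⇒≤ {f = position} λ {i} {j} e →
    lookup-injective u (trans (lookup-position i) (trans (cong (lookup ys) e) (sym (lookup-position j))))
    where
    position : Fin (length xs) → Fin (length ys)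
    position i = index (xs⊆ys (∈-lookup {xs = xs} i))
    lookup-position : ∀ i → lookup xs i ≡ lookup ys (position i)
    lookup-position i = lookup-index (xs⊆ys (∈-lookup {xs = xs} i))

module _ {G : Graph} (f : TotalLabeling G) where

  private
    color = inducedColor {G} f
    colors = List.map color (allFin (order G))

  numberOfColors-≥ : ∀ {xs} → Unique xs → (∀ {x} → x ∈ xs → ∃[ u ] x ≡ color u) → length xs ≤ numberOfColors {G} f
  numberOfColors-≥ u attained = unique-⊆⇒length≤ u λ x∈ → case attained x∈ of λ where
    (v , refl) → ∈-deduplicate⁺ _≟_ (∈-map⁺ color (∈-allFin v))

  numberOfColors-≤ : ∀ {xs} → (∀ u → color u ∈ xs) → numberOfColors {G} f ≤ length xs
  numberOfColors-≤ {xs} in-xs = unique-⊆⇒length≤ (deduplicate-! _≟_ colors) sub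
    where
    sub : deduplicate _≟_ colors ⊆ xs
    sub x∈ with ∈-map⁻ color (∈-deduplicate⁻ _≟_ colors x∈)
    ... | u , _ , refl = in-xs u

-- If only the colours of vertices 0 and 1 occurred, they would alternate, so every even vertex
-- would have the colour of 0. The last vertex has an even index and is adjacent to 0.
odd-cycle-third-color : ∀ {s} (c : Fin (suc (suc s * 2)) → ℕ) → (∀ {u v} → Next u v → c u ≢ c v) →
  ∃[ j ] c j ≢ c Fin.zero × c j ≢ c (Fin.suc Fin.zero)
odd-cycle-third-color {s} c proper with any? (λ j → ¬? (c j ≟ c Fin.zero) ×-dec ¬? (c j ≟ c (Fin.suc Fin.zero)))
... | yes found = found
... | no none = contradiction (trans (cong c (Finₚ.fromℕ-def (suc s * 2))) (evens (suc s) ≤-refl))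
                  (proper (inj₂ (cong suc (toℕ-fromℕ (suc s * 2)) , refl)))
  where
  k = suc (suc s * 2)
  otherwise : ∀ j → c j ≢ c Fin.zero → c j ≡ c (Fin.suc Fin.zero)
  otherwise j ≢0 with c j ≟ c (Fin.suc Fin.zero)
  ... | yes e = e
  ... | no ≢1 = contradiction (j , ≢0 , ≢1) none
  otherwise′ : ∀ j → c j ≢ c (Fin.suc Fin.zero) → c j ≡ c Fin.zero
  otherwise′ j ≢1 with c j ≟ c Fin.zero
  ... | yes e = e
  ... | no ≢0 = contradiction (j , ≢0 , ≢1) none
  next-fromℕ< : ∀ {i} (p : i < k) (q : suc i < k) → Next (fromℕ< p) (fromℕ< q)
  next-fromℕ< p q = inj₁ (trans (cong suc (toℕ-fromℕ< p)) (sym (toℕ-fromℕ< q)))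
  evens : ∀ t (p : t * 2 < k) → c (fromℕ< p) ≡ c Fin.zero
  evens zero p = refl
  evens (suc t) p = otherwise′ _ λ e → proper (next-fromℕ< p₁ p) (trans
      (otherwise _ λ e′ → proper (next-fromℕ< p₀ p₁) (trans (evens t p₀) (sym e′))) (sym e))
    where
    p₁ : suc (t * 2) < k
    p₁ = <-trans ≤-refl p
    p₀ : t * 2 < k
    p₀ = <-trans ≤-refl p₁

module _ {m s : ℕ} (3≤m : 3 ≤ suc (suc m)) (3≤k : 3 ≤ suc (suc s * 2)) where

  private
    C = cycle (suc (suc m)) 3≤m
    D = cycle (suc (suc s * 2)) 3≤k

  -- Two adjacent vertices of `C` and three differently coloured vertices of the odd cycle `D` serve
  -- as witnesses; every cross pair is adjacent, so the two groups share no colour.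
  numberOfColors≥5 : ∀ f → IsLocalTotalNeighborhoodAntimagic {C ∨ D} f → 5 ≤ numberOfColors {C ∨ D} f
  numberOfColors≥5 f proper = numberOfColors-≥ {C ∨ D} f unique (λ where
      (here refl) → u₀ , refl
      (there (here refl)) → u₁ , refl
      (there (there (here refl))) → v₀ , refl
      (there (there (there (here refl)))) → v₁ , refl
      (there (there (there (there (here refl))))) → v₂ , refl)
    where
    color = inducedColor {C ∨ D} f
    L : Fin (suc (suc m)) → Vertex (C ∨ D)
    L i = i ↑ˡ order D
    R : Fin (suc (suc s * 2)) → Vertex (C ∨ D)
    R j = order C ↑ʳ j
    third : ∃[ j ] color (R j) ≢ color (R Fin.zero) × color (R j) ≢ color (R (Fin.suc Fin.zero))
    third = odd-cycle-third-color {s} (color ∘ R) λ {u} {v} nxt → proper (R u) (R v) (adjʳʳ C D {u} {v} (inj₁ nxt))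
    u₀ u₁ v₀ v₁ v₂ : Vertex (C ∨ D)
    u₀ = L Fin.zero
    u₁ = L (Fin.suc Fin.zero)
    v₀ = R Fin.zero
    v₁ = R (Fin.suc Fin.zero)
    v₂ = R (proj₁ third)
    L≢R : ∀ i j → color (L i) ≢ color (R j)
    L≢R i j = proper (L i) (R j) (adjˡʳ C D i j)
    L≢R₀ = L≢R Fin.zero
    L≢R₁ = L≢R (Fin.suc Fin.zero)
    unique : Unique (color u₀ ∷ color u₁ ∷ color v₀ ∷ color v₁ ∷ color v₂ ∷ [])
    unique =
      (proper u₀ u₁ (adjˡˡ C D {Fin.zero} {Fin.suc Fin.zero} (inj₁ (inj₁ refl))) ∷ L≢R₀ Fin.zero ∷ L≢R₀ (Fin.suc Fin.zero) ∷ L≢R₀ (proj₁ third) ∷ []) ∷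
      (L≢R₁ Fin.zero ∷ L≢R₁ (Fin.suc Fin.zero) ∷ L≢R₁ (proj₁ third) ∷ []) ∷
      (proper v₀ v₁ (adjʳʳ C D {Fin.zero} {Fin.suc Fin.zero} (inj₁ (inj₁ refl))) ∷ proj₁ (proj₂ third) ∘ sym ∷ []) ∷
      (proj₂ (proj₂ third) ∘ sym ∷ []) ∷ [] ∷ []

join-noIsolated : ∀ (G H : Graph) → Vertex G → Vertex H → NoIsolatedVertices (G ∨ H)
join-noIsolated G H u₀ v₀ x with side (order G) (order H) x
... | left u  = order G ↑ʳ v₀ , adjˡʳ G H u v₀
... | right v = u₀ ↑ˡ order H , symm (G ∨ H) {u₀ ↑ˡ order H} {order G ↑ʳ v} (adjˡʳ G H u₀ v)

-- Colours in a join of two cycles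

∑-cong : ∀ {n} {f g : Fin n → ℕ} → (∀ i → f i ≡ g i) → ∑ f ≡ ∑ g
∑-cong = sum-cong-≗ +-0-monoid

∑-split : ∀ m {k} (f : Fin (m + k) → ℕ) → ∑ f ≡ ∑ (λ i → f (i ↑ˡ k)) + ∑ (λ j → f (m ↑ʳ j))
∑-split zero    f = refl
∑-split (suc m) f = trans (cong (f Fin.zero +_) (∑-split m (f ∘ Fin.suc))) (sym (+-assoc (f Fin.zero) _ _))

-- Within its own cycle a vertex receives contributions only from its predecessor and its successor.
∑-two-points : ∀ {n} (f : Fin n → ℕ) {p q} → p ≢ q → (∀ x → x ≢ p → x ≢ q → f x ≡ 0) → ∑ f ≡ f p + f q
∑-two-points {suc zero} f {Fin.zero} {Fin.zero} p≢q _ = contradiction refl p≢q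
∑-two-points {suc (suc n)} f {p} {q} p≢q f≡0 = begin
  ∑ f                                             ≡⟨ sum-remove +-0-commutativeMonoid {i = p} f ⟩
  f p + ∑ f′                                      ≡⟨ cong (f p +_) (sum-remove +-0-commutativeMonoid {i = q′} f′) ⟩
  f p + (f′ q′ + ∑ (λ x → f′ (punchIn q′ x)))     ≡⟨ cong (λ z → f p + (f′ q′ + z)) rest ⟩
  f p + (f′ q′ + 0)                               ≡⟨ cong (f p +_) (+-identityʳ (f′ q′)) ⟩
  f p + f (punchIn p q′)                          ≡⟨ cong (λ z → f p + f z) (punchIn-punchOut p≢q) ⟩
  f p + f q                                       ∎
  where
  open ≡-Reasoning
  f′ = λ x → f (punchIn p x)
  q′ = punchOut p≢q
  rest : ∑ (λ x → f′ (punchIn q′ x)) ≡ 0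
  rest = trans (∑-cong λ x → f≡0 _ (punchInᵢ≢i p _)
      (λ e → punchInᵢ≢i q′ x (Finₚ.punchIn-injective p _ _ (trans e (sym (punchIn-punchOut p≢q))))))
    (sum-replicate-zero +-0-monoid n)

module _ {G : Graph} (f : TotalLabeling G) where

  contribution-adj : ∀ {u x} (d : Dec (Adj G u x)) (a : Adj G u x) →
    contribution {G} f u x d ≡ label {G} f (inj₂ (edge G u x a)) + label {G} f (inj₁ x)
  contribution-adj (yes _) a = refl
  contribution-adj (no ¬a) a = contradiction a ¬a

  contribution-¬adj : ∀ {u x} (d : Dec (Adj G u x)) → ¬ Adj G u x → contribution {G} f u x d ≡ 0
  contribution-¬adj (yes a) ¬a = contradiction a ¬a
  contribution-¬adj (no _)  _  = refl

module _ {m k : ℕ} (3≤m : 3 ≤ m) (3≤k : 3 ≤ k) where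

  private
    C = cycle m 3≤m
    D = cycle k 3≤k
    J = C ∨ D

  uu : Fin m → JoinEdge C D
  uu i = inj₁ (inj₁ (cycleEdge 3≤m i))
  vv : Fin k → JoinEdge C D
  vv j = inj₁ (inj₂ (cycleEdge 3≤k j))
  uv : Fin m → Fin k → JoinEdge C D
  uv i j = inj₂ (i , j)

  module _ (f : TotalLabeling J) where

    private
      ℓ = label {J} f
      col = inducedColor {J} f

    uLabel : Fin m → ℕ
    uLabel i = ℓ (inj₁ (i ↑ˡ k))
    vLabel : Fin k → ℕ
    vLabel j = ℓ (inj₁ (m ↑ʳ j))
    uuLabel : Fin m → ℕ
    uuLabel i = ℓ (inj₂ (fromJoinEdge C D (uu i)))
    vvLabel : Fin k → ℕ
    vvLabel j = ℓ (inj₂ (fromJoinEdge C D (vv j)))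
    uvLabel : Fin m → Fin k → ℕ
    uvLabel i j = ℓ (inj₂ (fromJoinEdge C D (uv i j)))

    private
      share : (u x : Vertex J) → ℕ
      share u x = contribution {J} f u x (adj? J u x)

      share≡ : ∀ {u x} y (a : Adj J u x) → fromJoinEdge C D y ≡ edge J u x a →
        share u x ≡ ℓ (inj₂ (fromJoinEdge C D y)) + ℓ (inj₁ x)
      share≡ {u} {x} y a e = trans (contribution-adj f (adj? J u x) a) (cong (λ z → ℓ (inj₂ z) + ℓ (inj₁ x)) (sym e))

    -- Cycle edges are indexed by their tails, so the edge to the predecessor `p` carries
    -- `uuLabel p` and the edge to the successor `x` carries `uuLabel i`.
    color-u : ∀ {p i x} → Next p i → Next i x →
      col (i ↑ˡ k) ≡ (uuLabel p + uLabel p) + (uuLabel i + uLabel x) + ∑ (λ j → uvLabel i j + vLabel j)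
    color-u {p} {i} {x} p→i i→x = trans (∑-split m (share u)) (cong₂ _+_ cyc (∑-cong cross))
      where
      u = i ↑ˡ k
      forward : share u (x ↑ˡ k) ≡ uuLabel i + uLabel x
      forward = share≡ {u} {x ↑ˡ k} (uu i) (adjˡˡ C D {i} {x} (inj₁ i→x)) (trans
        (cong (λ z → fromJoinEdge C D (inj₁ (inj₁ z))) (sym (cycleEdge≡ 3≤m i→x)))
        (fromJoinEdge-ˡˡ C D i x (inj₁ i→x)))
      backward : share u (p ↑ˡ k) ≡ uuLabel p + uLabel p
      backward = share≡ {u} {p ↑ˡ k} (uu p) (adjˡˡ C D {i} {p} (inj₂ p→i)) (trans
        (cong (λ z → fromJoinEdge C D (inj₁ (inj₁ z))) (trans (sym (cycleEdge≡ 3≤m p→i)) (edge-sym C p i (inj₁ p→i))))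
        (fromJoinEdge-ˡˡ C D i p (inj₂ p→i)))
      p≢x : p ≢ x
      p≢x refl = next-asym 3≤m p→i i→x
      far : ∀ y → y ≢ p → y ≢ x → share u (y ↑ˡ k) ≡ 0
      far y y≢p y≢x = contribution-¬adj f (adj? J u (y ↑ˡ k)) λ a → case adjˡˡ⁻¹ C D {i} {y} a of λ where
        (inj₁ i→y) → y≢x (next-uniqueʳ i→y i→x)
        (inj₂ y→i) → y≢p (next-uniqueˡ y→i p→i)
      cyc : ∑ (λ y → share u (y ↑ˡ k)) ≡ (uuLabel p + uLabel p) + (uuLabel i + uLabel x)
      cyc = trans (∑-two-points (λ y → share u (y ↑ˡ k)) p≢x far) (cong₂ _+_ backward forward)
      cross : ∀ j → share u (m ↑ʳ j) ≡ uvLabel i j + vLabel j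
      cross j = share≡ {u} {m ↑ʳ j} (uv i j) (adjˡʳ C D i j) (fromJoinEdge-ˡʳ C D i j)

    color-v : ∀ {p j x} → Next p j → Next j x →
      col (m ↑ʳ j) ≡ ∑ (λ i → uvLabel i j + uLabel i) + ((vvLabel p + vLabel p) + (vvLabel j + vLabel x))
    color-v {p} {j} {x} p→j j→x = trans (∑-split m (share v)) (cong₂ _+_ (∑-cong cross) cyc)
      where
      v = m ↑ʳ j
      forward : share v (m ↑ʳ x) ≡ vvLabel j + vLabel x
      forward = share≡ {v} {m ↑ʳ x} (vv j) (adjʳʳ C D {j} {x} (inj₁ j→x)) (trans
        (cong (λ z → fromJoinEdge C D (inj₁ (inj₂ z))) (sym (cycleEdge≡ 3≤k j→x)))
        (fromJoinEdge-ʳʳ C D j x (inj₁ j→x)))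
      backward : share v (m ↑ʳ p) ≡ vvLabel p + vLabel p
      backward = share≡ {v} {m ↑ʳ p} (vv p) (adjʳʳ C D {j} {p} (inj₂ p→j)) (trans
        (cong (λ z → fromJoinEdge C D (inj₁ (inj₂ z))) (trans (sym (cycleEdge≡ 3≤k p→j)) (edge-sym D p j (inj₁ p→j))))
        (fromJoinEdge-ʳʳ C D j p (inj₂ p→j)))
      p≢x : p ≢ x
      p≢x refl = next-asym 3≤k p→j j→x
      far : ∀ y → y ≢ p → y ≢ x → share v (m ↑ʳ y) ≡ 0
      far y y≢p y≢x = contribution-¬adj f (adj? J v (m ↑ʳ y)) λ a → case adjʳʳ⁻¹ C D {j} {y} a of λ where
        (inj₁ j→y) → y≢x (next-uniqueʳ j→y j→x)
        (inj₂ y→j) → y≢p (next-uniqueˡ y→j p→j)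
      cyc : ∑ (λ y → share v (m ↑ʳ y)) ≡ (vvLabel p + vLabel p) + (vvLabel j + vLabel x)
      cyc = trans (∑-two-points (λ y → share v (m ↑ʳ y)) p≢x far) (cong₂ _+_ backward forward)
      cross : ∀ i → share v (i ↑ˡ k) ≡ uvLabel i j + uLabel i
      cross i = share≡ {v} {i ↑ˡ k} (uv i j) (symm J {i ↑ˡ k} {v} (adjˡʳ C D i j))
        (trans (fromJoinEdge-ˡʳ C D i j) (edge-sym J (i ↑ˡ k) v (adjˡʳ C D i j)))

  -- Instead of evaluating the double sum, the edges are counted by a bijection: `m` and `k` cycle
  -- edges and `m * k` cross edges.
  size-join : size J ≡ m + k + m * k
  size-join = ↔⇒≡ (count ↔-∘ ↔-sym (Edge↔Fin-size J))
    where
    count : Edge J ↔ Fin (m + k + m * k)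
    count = ↔-sym +↔⊎ ↔-∘ (((↔-sym +↔⊎ ↔-∘ (Edge-cycle↔Fin 3≤m ⊎-↔ Edge-cycle↔Fin 3≤k)) ⊎-↔ ↔-sym *↔×)
      ↔-∘ ↔-sym (JoinEdge↔Edge C D))

-- Numberings of blocks and the labeling they induce

record Numbering (A : Set) (n : ℕ) : Set where
  field
    code      : A → ℕ
    code<     : ∀ x → code x < n
    injective : ∀ {x y} → code x ≡ code y → x ≡ y

open Numbering

pull : ∀ {A B n} (g : A → B) → (∀ {x y} → g x ≡ g y → x ≡ y) → Numbering B n → Numbering A n
pull g g-inj N = record { code = code N ∘ g ; code< = code< N ∘ g ; injective = g-inj ∘ injective N }

infixr 5 _⊕_
_⊕_ : ∀ {A B n o} → Numbering A n → Numbering B o → Numbering (A ⊎ B) (n + o)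
_⊕_ {n = n} M N = record
  { code      = Sum.[ code M , (n +_) ∘ code N ]′
  ; code<     = λ { (inj₁ x) → <-≤-trans (code< M x) (m≤m+n n _) ; (inj₂ y) → +-monoʳ-< n (code< N y) }
  ; injective = λ
    { {inj₁ _} {inj₁ _} e → cong inj₁ (injective M e)
    ; {inj₂ _} {inj₂ _} e → cong inj₂ (injective N (+-cancelˡ-≡ n _ _ e))
    ; {inj₁ x} {inj₂ y} e → contradiction e (apart x y)
    ; {inj₂ y} {inj₁ x} e → contradiction (sym e) (apart x y)
    }
  }
  where
  apart : ∀ x y → code M x ≢ n + code N y
  apart x y = <⇒≢ (<-≤-trans (code< M x) (m≤m+n n _))

module _ {m k : ℕ} (3≤m : 3 ≤ m) (3≤k : 3 ≤ k)
         (a e : Numbering (Fin m) m) (b g : Numbering (Fin k) k)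
         (w : Numbering (Fin m × Fin k) (m * k)) where

  private
    C = cycle m 3≤m
    D = cycle k 3≤k
    J = C ∨ D

    toJoinEdge : Edge J → JoinEdge C D
    toJoinEdge = Inverse.from (JoinEdge↔Edge C D)

    vertices : Numbering (Vertex J) (m + k)
    vertices = pull (splitAt m) (Injection.injective (↔⇒↣ (+↔⊎ {m} {k}))) (a ⊕ b)

    joinEdges : Numbering (JoinEdge C D) (m + k + m * k)
    joinEdges = (pull (tail 3≤m) (Injection.injective (↔⇒↣ (Edge-cycle↔Fin 3≤m))) e
               ⊕ pull (tail 3≤k) (Injection.injective (↔⇒↣ (Edge-cycle↔Fin 3≤k))) g)
               ⊕ w

    edges : Numbering (Edge J) (m + k + m * k)
    edges = pull toJoinEdge (Injection.injective (↔⇒↣ (↔-sym (JoinEdge↔Edge C D)))) joinEdges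

    -- The swap gives the small labels to the edges and the largest `m + k` labels to the vertices.
    total : Numbering (Vertex J ⊎ Edge J) (m + k + m * k + (m + k))
    total = pull Sum.swap (Injection.injective (↔⇒↣ swap-↔)) (edges ⊕ vertices)

    total< : ∀ x → code total x < order J + size J
    total< x = subst (code total x <_)
      (trans (+-comm _ (m + k)) (cong (m + k +_) (sym (size-join 3≤m 3≤k)))) (code< total x)

  labeling : TotalLabeling J
  labeling = fromCode J (code total) total< (injective total)

  private
    label≡ : ∀ x → label {J} labeling x ≡ suc (code total x)
    label≡ = label-fromCode J (code total) total< (injective total)

    edgeLabel≡ : ∀ x → label {J} labeling (inj₂ (fromJoinEdge C D x)) ≡ suc (code joinEdges x)
    edgeLabel≡ x = trans (label≡ (inj₂ (fromJoinEdge C D x))) (cong (suc ∘ code joinEdges) (Inverse.strictlyInverseʳ (JoinEdge↔Edge C D) x))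

  uLabel≡ : ∀ i → uLabel 3≤m 3≤k labeling i ≡ suc (m + k + m * k + code a i)
  uLabel≡ i = trans (label≡ (inj₁ (i ↑ˡ k))) (cong (λ z → suc (m + k + m * k + code (a ⊕ b) z)) (splitAt-↑ˡ m i k))

  vLabel≡ : ∀ j → vLabel 3≤m 3≤k labeling j ≡ suc (m + k + m * k + (m + code b j))
  vLabel≡ j = trans (label≡ (inj₁ (m ↑ʳ j))) (cong (λ z → suc (m + k + m * k + code (a ⊕ b) z)) (splitAt-↑ʳ m k j))

  uuLabel≡ : ∀ i → uuLabel 3≤m 3≤k labeling i ≡ suc (code e i)
  uuLabel≡ i = trans (edgeLabel≡ (uu 3≤m 3≤k i)) (cong (suc ∘ code e) (tail-cycleEdge 3≤m i))

  vvLabel≡ : ∀ j → vvLabel 3≤m 3≤k labeling j ≡ suc (m + code g j)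
  vvLabel≡ j = trans (edgeLabel≡ (vv 3≤m 3≤k j)) (cong (λ z → suc (m + code g z)) (tail-cycleEdge 3≤k j))

  uvLabel≡ : ∀ i j → uvLabel 3≤m 3≤k labeling i j ≡ suc (m + k + code w (i , j))
  uvLabel≡ i j = edgeLabel≡ (uv 3≤m 3≤k i j)

  private
    q = m + k + m * k

  color-u≡ : ∀ {p i x} → Next p i → Next i x → inducedColor {J} labeling (i ↑ˡ k)
    ≡ (suc (code e p) + suc (q + code a p)) + (suc (code e i) + suc (q + code a x))
      + ∑ (λ j → suc (m + k + code w (i , j)) + suc (q + (m + code b j)))
  color-u≡ {p} {i} {x} p→i i→x = trans (color-u 3≤m 3≤k labeling p→i i→x) (cong₂ _+_
    (cong₂ _+_ (cong₂ _+_ (uuLabel≡ p) (uLabel≡ p)) (cong₂ _+_ (uuLabel≡ i) (uLabel≡ x)))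
    (∑-cong λ j → cong₂ _+_ (uvLabel≡ i j) (vLabel≡ j)))

  color-v≡ : ∀ {p j x} → Next p j → Next j x → inducedColor {J} labeling (m ↑ʳ j)
    ≡ ∑ (λ i → suc (m + k + code w (i , j)) + suc (q + code a i))
      + ((suc (m + code g p) + suc (q + (m + code b p))) + (suc (m + code g j) + suc (q + (m + code b x))))
  color-v≡ {p} {j} {x} p→j j→x = trans (color-v 3≤m 3≤k labeling p→j j→x) (cong₂ _+_
    (∑-cong λ i → cong₂ _+_ (uvLabel≡ i j) (uLabel≡ i))
    (cong₂ _+_ (cong₂ _+_ (vvLabel≡ p) (vLabel≡ p)) (cong₂ _+_ (vvLabel≡ j) (vLabel≡ x))))

-- The labels

byParity : {A : Set} → (ℕ → A) → (ℕ → A) → ℕ → A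
byParity f g zero          = f 0
byParity f g (suc zero)    = g 0
byParity f g (suc (suc i)) = byParity (f ∘ suc) (g ∘ suc) i

module _ {A : Set} where

  byParity-even : ∀ (f g : ℕ → A) t → byParity f g (t * 2) ≡ f t
  byParity-even f g zero    = refl
  byParity-even f g (suc t) = byParity-even (f ∘ suc) (g ∘ suc) t

  byParity-odd : ∀ (f g : ℕ → A) t → byParity f g (suc (t * 2)) ≡ g t
  byParity-odd f g zero    = refl
  byParity-odd f g (suc t) = byParity-odd (f ∘ suc) (g ∘ suc) t

data EvenOrOdd : ℕ → Set where
  even : ∀ t → EvenOrOdd (t * 2)
  odd  : ∀ t → EvenOrOdd (suc (t * 2))

evenOrOdd : ∀ i → EvenOrOdd i
evenOrOdd zero = even 0
evenOrOdd (suc i) with evenOrOdd i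
... | even t = odd t
... | odd t  = even (suc t)

halve-< : ∀ {t p} → t * 2 < p * 2 → t < p
halve-< {t} {p} = *-cancelʳ-< 2 t p

halve-odd-< : ∀ {t p} → suc (t * 2) < p * 2 → t < p
halve-odd-< lt = halve-< (<-trans ≤-refl lt)

halve-≤ : ∀ {t p} → t * 2 < suc (p * 2) → t ≤ p
halve-≤ {t} {p} (s≤s le) = *-cancelʳ-≤ t p 2 le

double-odd-< : ∀ {t p} → t < p → suc (t * 2) < p * 2
double-odd-< t<p = *-monoˡ-≤ 2 t<p

double-< : ∀ {t p} → t < p → t * 2 < p * 2
double-< {t} {p} = *-monoˡ-< 2

-- The reflection of {0, …, N − 1}; 0 for x ≥ N.
comp : ℕ → ℕ → ℕ
comp N x = N ∸ suc x

comp-+ : ∀ {N x} → x < N → suc (x + comp N x) ≡ N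
comp-+ = m+[n∸m]≡n

comp< : ∀ {N x} → x < N → comp N x < N
comp< {N} {x} x<N = subst (comp N x <_) (comp-+ x<N) (s≤s (m≤n+m (comp N x) x))

comp-injective : ∀ {N x y} → x < N → y < N → comp N x ≡ comp N y → x ≡ y
comp-injective {N} {x} {y} x<N y<N e = suc-injective (∸-cancelˡ-≡ x<N y<N e)

-- Reflection carries the lowest `a` numbers to the highest `a`, which all lie at or above `b`. This
-- keeps label ranges apart.
comp-≥ : ∀ {a b N x} → a + b ≡ N → x < a → b ≤ comp N x
comp-≥ {a} {b} {x = x} refl x<a = subst (_≤ comp (a + b) x) (m+n∸m≡n a b) (∸-monoʳ-≤ (a + b) x<a)

InjectiveBelow : ℕ → (ℕ → ℕ) → Set
InjectiveBelow n f = ∀ {i j} → i < n → j < n → f i ≡ f j → i ≡ j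

MapsBelow : ℕ → ℕ → (ℕ → ℕ) → Set
MapsBelow n N f = ∀ {i} → i < n → f i < N

module _ {p : ℕ} {f g : ℕ → ℕ} where

  byParity-mapsBelow : ∀ {N} → MapsBelow p N f → MapsBelow p N g → MapsBelow (p * 2) N (byParity f g)
  byParity-mapsBelow {N} f< g< {i} i< with evenOrOdd i
  ... | even t = subst (_< N) (sym (byParity-even f g t)) (f< (halve-< i<))
  ... | odd t  = subst (_< N) (sym (byParity-odd f g t)) (g< (halve-odd-< i<))

  byParity-injectiveBelow : InjectiveBelow p f → InjectiveBelow p g →
    (∀ {t u} → t < p → u < p → f t ≢ g u) → InjectiveBelow (p * 2) (byParity f g)
  byParity-injectiveBelow f-inj g-inj f≢g {i} {j} i< j< e with evenOrOdd i | evenOrOdd j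
  ... | even t | even u = cong (_* 2) (f-inj (halve-< i<) (halve-< j<)
    (trans (sym (byParity-even f g t)) (trans e (byParity-even f g u))))
  ... | odd t | odd u = cong (suc ∘ (_* 2)) (g-inj (halve-odd-< i<) (halve-odd-< j<)
    (trans (sym (byParity-odd f g t)) (trans e (byParity-odd f g u))))
  ... | even t | odd u = contradiction (trans (sym (byParity-even f g t)) (trans e (byParity-odd f g u)))
    (f≢g (halve-< i<) (halve-odd-< j<))
  ... | odd t | even u = contradiction (sym (trans (sym (byParity-odd f g t)) (trans e (byParity-even f g u))))
    (f≢g (halve-< j<) (halve-odd-< i<))

-- Sums over initial segments and the zigzag

∑< : ℕ → (ℕ → ℕ) → ℕ
∑< n f = ∑ {n} (f ∘ toℕ)

∑<-last : ∀ n f → ∑< (suc n) f ≡ ∑< n f + f n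
∑<-last zero    f = +-identityʳ (f 0)
∑<-last (suc n) f = trans (cong (f 0 +_) (∑<-last n (f ∘ suc))) (sym (+-assoc (f 0) _ _))

∑<-pairs : ∀ p f {c} → (∀ {t} → t < p → f (t * 2) + f (suc (t * 2)) ≡ c) → ∑< (p * 2) f ≡ p * c
∑<-pairs zero    f pair = refl
∑<-pairs (suc p) f {c} pair = begin
  f 0 + (f 1 + ∑< (p * 2) (f ∘ suc ∘ suc)) ≡⟨ +-assoc (f 0) (f 1) _ ⟨
  (f 0 + f 1) + ∑< (p * 2) (f ∘ suc ∘ suc) ≡⟨ cong₂ _+_ (pair z<s) (∑<-pairs p (f ∘ suc ∘ suc) (pair ∘ s<s)) ⟩
  c + p * c ∎
  where open ≡-Reasoning

-- A permutation of {0, …, 2n} whose cyclically consecutive sums are n + t.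
zigzag : ℕ → ℕ → ℕ
zigzag n = byParity (n +_) id

zigzag-even : ∀ n r → zigzag n (r * 2) ≡ n + r
zigzag-even n = byParity-even (n +_) id

zigzag-odd : ∀ n r → zigzag n (suc (r * 2)) ≡ r
zigzag-odd n = byParity-odd (n +_) id

zigzag-suc : ∀ n t → zigzag n t + zigzag n (suc t) ≡ n + t
zigzag-suc n t with evenOrOdd t
... | even r rewrite zigzag-even n r | zigzag-odd n r = solve-eq n r
  where
  solve-eq : ∀ n r → n + r + r ≡ n + r * 2
  solve-eq = solve-∀
... | odd r rewrite zigzag-odd n r | zigzag-even n (suc r) = solve-eq n r
  where
  solve-eq : ∀ n r → r + (n + suc r) ≡ n + suc (r * 2)
  solve-eq = solve-∀

-- The last index `n * 2` is even, so the seam adds two values of the even branch, `n + n` and `n`;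
-- this is where odd length enters.
zigzag-wrap : ∀ n → zigzag n (n * 2) + zigzag n 0 ≡ n + n * 2
zigzag-wrap n rewrite zigzag-even n n = solve-eq n
  where
  solve-eq : ∀ n → n + n + (n + 0) ≡ n + n * 2
  solve-eq = solve-∀

-- `Next` on the underlying numbers, so that the arithmetic can be done without `Fin`.
Follows : ℕ → ℕ → ℕ → Set
Follows k i j = suc i ≡ j ⊎ (suc i ≡ k × j ≡ 0)

zigzag-follows : ∀ n {t u} → Follows (suc (n * 2)) t u → zigzag n t + zigzag n u ≡ n + t
zigzag-follows n (inj₁ refl)          = zigzag-suc n _
zigzag-follows n (inj₂ (refl , refl)) = zigzag-wrap n

zigzag< : ∀ n → MapsBelow (suc (n * 2)) (suc (n * 2)) (zigzag n)
zigzag< n {i} i< with evenOrOdd i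
... | even t rewrite zigzag-even n t = s≤s (≤-trans (+-monoʳ-≤ n (halve-≤ i<)) (≤-reflexive (solve-eq n)))
  where
  solve-eq : ∀ n → n + n ≡ n * 2
  solve-eq = solve-∀
... | odd t rewrite zigzag-odd n t = ≤-trans (s≤s (m≤m*n t 2)) (<⇒≤ i<)

-- Even indices give values from `n` upwards, odd indices values below `n`, and each branch is
-- injective.
zigzag-injective : ∀ n → InjectiveBelow (suc (n * 2)) (zigzag n)
zigzag-injective n {i} {j} i< j< e with evenOrOdd i | evenOrOdd j
... | even t | even u rewrite zigzag-even n t | zigzag-even n u = cong (_* 2) (+-cancelˡ-≡ n t u e)
... | odd t  | odd u  rewrite zigzag-odd n t | zigzag-odd n u = cong (suc ∘ (_* 2)) e
... | even t | odd u  rewrite zigzag-even n t | zigzag-odd n u =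
  contradiction (sym e) (<⇒≢ (≤-trans (halve-< (s≤s⁻¹ j<)) (m≤m+n n t)))
... | odd t  | even u rewrite zigzag-odd n t | zigzag-even n u =
  contradiction e (<⇒≢ (≤-trans (halve-< (s≤s⁻¹ i<)) (m≤m+n n u)))

-- The first `p` pairs of terms sum to `p s + p (p - 1)`; `partial` adds `p` to avoid the
-- subtraction, and the same is done here with `s`.
∑<-zigzag : ∀ s → ∑< (suc (s * 2)) (zigzag s) ≡ s * suc (s * 2)
∑<-zigzag s = +-cancelʳ-≡ s _ _ (begin
  ∑< (suc (s * 2)) (zigzag s) + s                    ≡⟨ cong (_+ s) (∑<-last (s * 2) (zigzag s)) ⟩
  ∑< (s * 2) (zigzag s) + zigzag s (s * 2) + s       ≡⟨ cong (λ z → ∑< (s * 2) (zigzag s) + z + s) (zigzag-even s s) ⟩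
  ∑< (s * 2) (zigzag s) + (s + s) + s                ≡⟨ solve₁ s (∑< (s * 2) (zigzag s)) ⟩
  ∑< (s * 2) (zigzag s) + s + (s + s)                ≡⟨ cong (_+ (s + s)) (partial s) ⟩
  s * s + s * s + (s + s)                            ≡⟨ solve₂ s ⟩
  s * suc (s * 2) + s                                ∎)
  where
  open ≡-Reasoning
  solve₁ : ∀ s x → x + (s + s) + s ≡ x + s + (s + s)
  solve₁ = solve-∀
  solve₂ : ∀ s → s * s + s * s + (s + s) ≡ s * suc (s * 2) + s
  solve₂ = solve-∀
  solve₃ : ∀ s p x → x + (s + p) + p + suc p ≡ (x + p) + (s + p + suc p)
  solve₃ = solve-∀
  solve₄ : ∀ s p → (p * s + p * p) + (s + p + suc p) ≡ suc p * s + suc p * suc p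
  solve₄ = solve-∀
  partial : ∀ p → ∑< (p * 2) (zigzag s) + p ≡ p * s + p * p
  partial zero = refl
  partial (suc p) = begin
    ∑< (suc (suc (p * 2))) (zigzag s) + suc p
      ≡⟨ cong (_+ suc p) (trans (∑<-last (suc (p * 2)) (zigzag s)) (cong₂ _+_ (∑<-last (p * 2) (zigzag s)) (zigzag-odd s p))) ⟩
    ∑< (p * 2) (zigzag s) + zigzag s (p * 2) + p + suc p
      ≡⟨ cong (λ z → ∑< (p * 2) (zigzag s) + z + p + suc p) (zigzag-even s p) ⟩
    ∑< (p * 2) (zigzag s) + (s + p) + p + suc p ≡⟨ solve₃ s p (∑< (p * 2) (zigzag s)) ⟩
    (∑< (p * 2) (zigzag s) + p) + (s + p + suc p) ≡⟨ cong (_+ (s + p + suc p)) (partial p) ⟩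
    (p * s + p * p) + (s + p + suc p) ≡⟨ solve₄ s p ⟩
    suc p * s + suc p * suc p ∎

row-before : ∀ {m r s i} → i < m → r < s → r * m + i < s * m
row-before {m} {r} {s} {i} i<m r<s = begin-strict
  r * m + i <⟨ +-monoʳ-< (r * m) i<m ⟩
  r * m + m ≡⟨ +-comm (r * m) m ⟩
  suc r * m ≤⟨ *-monoˡ-≤ m r<s ⟩
  s * m     ∎
  where open ≤-Reasoning

divMod-unique : ∀ {m r r′ i i′} → i < m → i′ < m → r * m + i ≡ r′ * m + i′ → r ≡ r′ × i ≡ i′
divMod-unique {m} {r} {r′} {i} {i′} i<m i′<m e with ℕₚ.<-cmp r r′
... | tri< r<r′ _ _ = contradiction e (<⇒≢ (<-≤-trans (row-before i<m r<r′) (m≤m+n _ i′)))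
... | tri> _ _ r′<r = contradiction (sym e) (<⇒≢ (<-≤-trans (row-before i′<m r′<r) (m≤m+n _ i)))
... | tri≈ _ refl _ = refl , +-cancelˡ-≡ (r * m) i i′ e

atLast : {A : Set} → ℕ → ℕ → A → A → A
atLast l j x y with j ≟ l
... | yes _ = x
... | no _  = y

atLast-≡ : ∀ {A : Set} l {x y : A} → atLast l l x y ≡ x
atLast-≡ l with l ≟ l
... | yes _ = refl
... | no ≢  = contradiction refl ≢

atLast-< : ∀ {A : Set} {l j} {x y : A} → j < l → atLast l j x y ≡ y
atLast-< {l = l} {j} j<l with j ≟ l
... | yes refl = contradiction j<l (<-irrefl refl)
... | no _     = refl

double : ∀ x → x + x ≡ x * 2
double = solve-∀

-- The codes of vertices, cycle edges and join edges

module Codes (n s : ℕ) where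

  -- `q` is the size of the join. `Q` is `K - 2` written without subtraction, since the pair sums in
  -- the array turn out to be `Q`, `Q + 1` and `Q + 2`. The variable `n` enters through `n * 2`,
  -- which `U₀<V₂` generalises to one variable.
  h m k K q Q : ℕ
  h = suc (n * 2)
  m = h * 2
  k = suc (s * 2)
  K = m * k
  q = m + k + K
  Q = 4 * (n * 2 * s) + 2 * (n * 2) + 4 * s

  K≡ : K ≡ suc (suc Q)
  K≡ = eq n s
    where
    eq : ∀ n s → suc (n * 2) * 2 * suc (s * 2) ≡ suc (suc (4 * (n * 2 * s) + 2 * (n * 2) + 4 * s))
    eq = solve-∀

  -- The join codes form three consecutive ranges: the `s * m` low entries, the `m` entries of the
  -- last column, and the reflections of the low entries.
  K-split : K ≡ s * m + (s * m + m)
  K-split = eq s m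
    where
    eq : ∀ s m → m * suc (s * 2) ≡ s * m + (s * m + m)
    eq = solve-∀

  -- Labels within each block of the labeling, counted from 0: a and e for the
  -- vertices u_i and edges u_i u_{i+1} of C_m, b and g for those of C_k, M for the
  -- join edges u_i v_j, whose column j = 2s holds w.  The blocks are ordered
  -- e, g, M, a, b.
  a e w : ℕ → ℕ
  a = byParity (zigzag n) (comp m ∘ zigzag n)
  e = byParity (comp h) (h +_)
  w = byParity (h +_) (comp h)

  b g : ℕ → ℕ
  b = zigzag s
  g = comp k ∘ zigzag s

  h≤m : h ≤ m
  h≤m = m≤m*n h 2

  upper< : MapsBelow h m (h +_)
  upper< {t} t<h = subst (h + t <_) (double h) (+-monoʳ-< h t<h)

  lower≢upper : ∀ {t u} → t < h → u < h → comp h t ≢ h + u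
  lower≢upper t< u< = <⇒≢ (<-≤-trans (comp< t<) (m≤m+n h _))

  a< : MapsBelow m m a
  a< = byParity-mapsBelow (λ t< → <-≤-trans (zigzag< n t<) h≤m) (λ t< → comp< (<-≤-trans (zigzag< n t<) h≤m))

  a-injective : InjectiveBelow m a
  a-injective = byParity-injectiveBelow (zigzag-injective n)
    (λ {t} {u} t< u< → zigzag-injective n t< u< ∘ comp-injective (<-≤-trans (zigzag< n t<) h≤m) (<-≤-trans (zigzag< n u<) h≤m))
    (λ t< u< → <⇒≢ (<-≤-trans (zigzag< n t<) (comp-≥ (double h) (zigzag< n u<))))

  e< : MapsBelow m m e
  e< = byParity-mapsBelow (λ t< → <-≤-trans (comp< t<) h≤m) upper<

  e-injective : InjectiveBelow m e
  e-injective = byParity-injectiveBelow comp-injective (λ _ _ → +-cancelˡ-≡ h _ _) lower≢upper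

  w< : MapsBelow m m w
  w< = byParity-mapsBelow upper< (λ t< → <-≤-trans (comp< t<) h≤m)

  w-injective : InjectiveBelow m w
  w-injective = byParity-injectiveBelow (λ _ _ → +-cancelˡ-≡ h _ _) comp-injective (λ t< u< → lower≢upper u< t< ∘ sym)

  b< : MapsBelow k k b
  b< = zigzag< s

  g< : MapsBelow k k g
  g< j< = comp< (zigzag< s j<)

  g-injective : InjectiveBelow k g
  g-injective i< j< = zigzag-injective s i< j< ∘ comp-injective (zigzag< s i<) (zigzag< s j<)

  -- In columns `2 r` and `2 r + 1`, row `i` receives `r * m + i` and its reflection in `K`. The
  -- unreflected entry stands in the even column for even `i` and in the odd column for odd `i`,
  -- hence the shift to `suc i` in the odd columns of `M`.
  choose : ℕ → ℕ → ℕ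
  choose i x = byParity (λ _ → x) (λ _ → comp K x) i

  M : ℕ → ℕ → ℕ
  M i j = atLast (s * 2) j (s * m + w i)
    (byParity (λ r → choose i (r * m + i)) (λ r → choose (suc i) (r * m + i)) j)

  M-last : ∀ i → M i (s * 2) ≡ s * m + w i
  M-last i = atLast-≡ (s * 2)

  M-even : ∀ i {r} → r < s → M i (r * 2) ≡ choose i (r * m + i)
  M-even i {r} r<s = trans (atLast-< (double-< r<s)) (byParity-even _ _ r)

  M-odd : ∀ i {r} → r < s → M i (suc (r * 2)) ≡ choose (suc i) (r * m + i)
  M-odd i {r} r<s = trans (atLast-< (double-odd-< r<s)) (byParity-odd _ _ r)

  M-even-even : ∀ t {r} → r < s → M (t * 2) (r * 2) ≡ r * m + t * 2
  M-even-even t r<s = trans (M-even (t * 2) r<s) (byParity-even _ _ t)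

  M-odd-even : ∀ t {r} → r < s → M (suc (t * 2)) (r * 2) ≡ comp K (r * m + suc (t * 2))
  M-odd-even t r<s = trans (M-even (suc (t * 2)) r<s) (byParity-odd _ _ t)

  M-even-odd : ∀ t {r} → r < s → M (t * 2) (suc (r * 2)) ≡ comp K (r * m + t * 2)
  M-even-odd t r<s = trans (M-odd (t * 2) r<s) (byParity-odd _ _ t)

  M-odd-odd : ∀ t {r} → r < s → M (suc (t * 2)) (suc (r * 2)) ≡ r * m + suc (t * 2)
  M-odd-odd t {r} r<s = trans (M-odd (suc (t * 2)) r<s)
    (byParity-even (λ _ → r * m + suc (t * 2)) (λ _ → comp K (r * m + suc (t * 2))) (suc t))

  sm≤K : s * m ≤ K
  sm≤K = subst (s * m ≤_) (sym K-split) (m≤m+n _ _)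

  entry<K : ∀ {i r} → i < m → r < s → r * m + i < K
  entry<K i< r< = <-≤-trans (row-before i< r<) sm≤K

  -- The column of the `r`-th pair in which row `i` has its low entry; the high one is then in
  -- `column (suc i) r`.
  column : ℕ → ℕ → ℕ
  column i r = byParity (λ _ → 0) (λ _ → 1) i + r * 2

  column-even : ∀ t r → column (t * 2) r ≡ r * 2
  column-even t r = cong (_+ r * 2) (byParity-even _ _ t)

  column-odd : ∀ t r → column (suc (t * 2)) r ≡ suc (r * 2)
  column-odd t r = cong (_+ r * 2) (byParity-odd _ _ t)

  -- Sorts the entries by the three ranges of `K-split` and records how a position is recovered from
  -- its value.
  data Cell (i j : ℕ) : ℕ → Set where
    low  : ∀ r → r < s → j ≡ column i r → Cell i j (r * m + i)
    mid  : j ≡ s * 2 → Cell i j (s * m + w i)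
    high : ∀ r → r < s → j ≡ column (suc i) r → Cell i j (comp K (r * m + i))

  cell : ∀ i {j} → j < k → Cell i j (M i j)
  cell i {j} j< with evenOrOdd i | evenOrOdd j
  ... | even t | odd r = subst (Cell (t * 2) _) (sym (M-even-odd t r<s)) (high r r<s (sym (column-odd t r)))
    where r<s = halve-< {r} {s} (s≤s⁻¹ j<)
  ... | odd t | odd r = subst (Cell (suc (t * 2)) _) (sym (M-odd-odd t r<s)) (low r r<s (sym (column-odd t r)))
    where r<s = halve-< {r} {s} (s≤s⁻¹ j<)
  ... | i′ | even r with m≤n⇒m<n∨m≡n (halve-≤ {r} {s} j<)
  ...   | inj₂ refl = subst (Cell i _) (sym (M-last i)) (mid refl)
  cell i j< | even t | even r | inj₁ r<s =
    subst (Cell (t * 2) _) (sym (M-even-even t r<s)) (low r r<s (sym (column-even t r)))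
  cell i j< | odd t | even r | inj₁ r<s =
    subst (Cell (suc (t * 2)) _) (sym (M-odd-even t r<s)) (high r r<s (sym (column-even (suc t) r)))

  mid< : ∀ {i} → i < m → s * m + w i < s * m + m
  mid< i< = +-monoʳ-< (s * m) (w< i<)

  high≥ : ∀ {i r} → i < m → r < s → s * m + m ≤ comp K (r * m + i)
  high≥ i< r< = comp-≥ (sym K-split) (row-before i< r<)

  cell<K : ∀ {i j x} → i < m → Cell i j x → x < K
  cell<K i< (low r r< _)  = entry<K i< r<
  cell<K i< (mid _)       = <-≤-trans (mid< i<) (subst (s * m + m ≤_) (sym K-split) (m≤n+m _ (s * m)))
  cell<K i< (high r r< _) = comp< (entry<K i< r<)

  -- The three ranges are disjoint. In the low and high ranges, division by `m` recovers `r` and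
  -- `i`, and these determine the column; in the middle range `w` is injective.
  cell-unique : ∀ {i j i′ j′ x x′} → i < m → i′ < m → Cell i j x → Cell i′ j′ x′ → x ≡ x′ → i ≡ i′ × j ≡ j′
  cell-unique i< i′< (low r _ refl) (low r′ _ refl) eq
    with refl , refl ← divMod-unique {m} {r} {r′} i< i′< eq = refl , refl
  cell-unique i< i′< (mid refl) (mid refl) eq = w-injective i< i′< (+-cancelˡ-≡ (s * m) _ _ eq) , refl
  cell-unique i< i′< (high r r< refl) (high r′ r′< refl) eq
    with refl , refl ← divMod-unique {m} {r} {r′} i< i′< (comp-injective (entry<K i< r<) (entry<K i′< r′<) eq) = refl , refl
  cell-unique i< i′< (low r r< _) (mid _) eq =
    contradiction eq (<⇒≢ (<-≤-trans (row-before i< r<) (m≤m+n _ _)))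
  cell-unique i< i′< (mid _) (low r r< _) eq =
    contradiction (sym eq) (<⇒≢ (<-≤-trans (row-before i′< r<) (m≤m+n _ _)))
  cell-unique i< i′< (low r r< _) (high r′ r′< _) eq =
    contradiction eq (<⇒≢ (<-≤-trans (row-before i< r<) (≤-trans (m≤m+n _ m) (high≥ i′< r′<))))
  cell-unique i< i′< (high r′ r′< _) (low r r< _) eq =
    contradiction (sym eq) (<⇒≢ (<-≤-trans (row-before i′< r<) (≤-trans (m≤m+n _ m) (high≥ i< r′<))))
  cell-unique i< i′< (mid _) (high r r< _) eq = contradiction eq (<⇒≢ (<-≤-trans (mid< i<) (high≥ i′< r<)))
  cell-unique i< i′< (high r r< _) (mid _) eq = contradiction (sym eq) (<⇒≢ (<-≤-trans (mid< i′<) (high≥ i< r<)))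

-- Values of the colours

∑<-affine : ∀ N c (f g : ℕ → ℕ) {t : ℕ → ℕ} → (∀ j → t j ≡ c + (f j + g j)) →
  ∑< N t ≡ N * c + (∑< N f + ∑< N g)
∑<-affine zero    c f g eq = refl
∑<-affine (suc N) c f g {t} eq = trans
  (cong₂ _+_ (eq 0) (∑<-affine N c (f ∘ suc) (g ∘ suc) (eq ∘ suc)))
  (rearrange c (f 0) (g 0) (N * c) (∑< N (f ∘ suc)) (∑< N (g ∘ suc)))
  where
  rearrange : ∀ c x y z u v → c + (x + y) + (z + (u + v)) ≡ c + z + ((x + u) + (y + v))
  rearrange = solve-∀

module Colors (n s : ℕ) where

  open Codes n s

  -- The right side of `color-u≡` on numbers: `p` is the predecessor and `x` the successor of `i`.
  -- `vColor` does the same for `color-v≡`.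
  uColor : ℕ → ℕ → ℕ → ℕ
  uColor p i x = (suc (e p) + suc (q + a p)) + (suc (e i) + suc (q + a x))
    + ∑< k (λ j → suc (m + k + M i j) + suc (q + (m + b j)))

  vColor : ℕ → ℕ → ℕ → ℕ
  vColor p j x = ∑< m (λ i → suc (m + k + M i j) + suc (q + a i))
    + ((suc (m + g p) + suc (q + (m + b p))) + (suc (m + g j) + suc (q + (m + b x))))

  -- The two entries are reflections of each other, so they sum to `K - 1` whatever the parity of
  -- the row.
  row-pair : ∀ {i r} → i < m → r < s → M i (r * 2) + M i (suc (r * 2)) ≡ suc Q
  row-pair {i} {r} i<m r<s with evenOrOdd i
  ... | even t rewrite M-even-even t r<s | M-even-odd t r<s =
    suc-injective (trans (comp-+ (entry<K i<m r<s)) K≡)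
  ... | odd t rewrite M-odd-even t r<s | M-odd-odd t r<s =
    suc-injective (trans (cong suc (+-comm _ (r * m + suc (t * 2)))) (trans (comp-+ (entry<K i<m r<s)) K≡))

  row-sum : ∀ {i} → i < m → ∑< k (M i) ≡ s * suc Q + (s * m + w i)
  row-sum {i} i<m = trans (∑<-last (s * 2) (M i)) (cong₂ _+_ (∑<-pairs s (M i) (row-pair i<m)) (M-last i))

  -- The part of the cross contribution that is the same for all rows: constants, the `s` paired
  -- columns, and `s * k`, the sum of all `b`.
  R : ℕ
  R = k * (2 + (m + k) + (q + m)) + s * suc Q + s * k

  row-total : ∀ {i} → i < m → ∑< k (λ j → suc (m + k + M i j) + suc (q + (m + b j))) ≡ R + (s * m + w i)
  row-total {i} i<m = trans (∑<-affine k (2 + (m + k) + (q + m)) (M i) b (λ j → eq₁ (m + k) q m (M i j) (b j)))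
    (trans (cong₂ (λ x y → k * (2 + (m + k) + (q + m)) + (x + y)) (row-sum i<m) (∑<-zigzag s))
      (eq₂ (k * (2 + (m + k) + (q + m))) (s * suc Q) (s * m + w i) (s * k)))
    where
    eq₁ : ∀ A q m x y → suc (A + x) + suc (q + (m + y)) ≡ 2 + A + (q + m) + (x + y)
    eq₁ = solve-∀
    eq₂ : ∀ A x y z → A + ((x + y) + z) ≡ A + x + z + y
    eq₂ = solve-∀

  -- The last summands are what the codes leave once the index cancels: `13 n + 4` is
  -- `3 h + 2 m - 3 - n`, and `7 n + 1` is `3 h - 2 + n`.
  U₀ U₁ : ℕ
  U₀ = 4 + 2 * q + R + s * m + (13 * n + 4)
  U₁ = 4 + 2 * q + R + s * m + (7 * n + 1)

  -- The reflections `A` and `B` contribute `-(n + τ)`, which cancels the `τ` of one edge; `C`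
  -- cancels the `t` of the array column. Adding `3 + (x + y) + t` completes the three reflection
  -- equations and so avoids truncated subtraction.
  u-even-arith : ∀ {τ t A B C x y} q R S → suc (x + A) ≡ m → suc (y + B) ≡ m → suc (t + C) ≡ h → x + y ≡ n + τ →
    (suc (h + τ) + suc (q + A)) + (suc C + suc (q + B)) + (R + (S + (h + t))) ≡ 4 + 2 * q + R + S + (13 * n + 4)
  u-even-arith {τ} {t} {A} {B} {C} {x} {y} q R S xA yB tC xy = +-cancelʳ-≡ (3 + (x + y) + t) _ _ (begin
    (suc (h + τ) + suc (q + A)) + (suc C + suc (q + B)) + (R + (S + (h + t))) + (3 + (x + y) + t)
      ≡⟨ eq₁ h τ t A B C x y q R S ⟩
    4 + 2 * q + R + S + (h + τ) + (h + t) + (suc (x + A) + suc (y + B) + suc (t + C))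
      ≡⟨ cong (4 + 2 * q + R + S + (h + τ) + (h + t) +_) (cong₂ _+_ (cong₂ _+_ xA yB) tC) ⟩
    4 + 2 * q + R + S + (h + τ) + (h + t) + (m + m + h)
      ≡⟨ eq₂ n τ t (4 + 2 * q + R + S) ⟩
    4 + 2 * q + R + S + (13 * n + 4) + (3 + (n + τ) + t)
      ≡⟨ cong (λ z → 4 + 2 * q + R + S + (13 * n + 4) + (3 + z + t)) xy ⟨
    4 + 2 * q + R + S + (13 * n + 4) + (3 + (x + y) + t) ∎)
    where
    open ≡-Reasoning
    eq₁ : ∀ h τ t A B C x y q R S →
      (suc (h + τ) + suc (q + A)) + (suc C + suc (q + B)) + (R + (S + (h + t))) + (3 + (x + y) + t)
      ≡ 4 + 2 * q + R + S + (h + τ) + (h + t) + (suc (x + A) + suc (y + B) + suc (t + C))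
    eq₁ = solve-∀
    eq₂ : ∀ n τ t X → X + (suc (n * 2) + τ) + (suc (n * 2) + t) + (suc (n * 2) * 2 + suc (n * 2) * 2 + suc (n * 2))
      ≡ X + (13 * n + 4) + (3 + (n + τ) + t)
    eq₂ = solve-∀

  -- Here `C` occurs twice, for an edge and for the array column, and cancels the `t` of the other
  -- edge together with that of `x + y`.
  u-odd-arith : ∀ {t C x y} q R S → suc (t + C) ≡ h → x + y ≡ n + t →
    (suc C + suc (q + x)) + (suc (h + t) + suc (q + y)) + (R + (S + C)) ≡ 4 + 2 * q + R + S + (7 * n + 1)
  u-odd-arith {t} {C} {x} {y} q R S tC xy = +-cancelʳ-≡ (2 + 2 * t) _ _ (begin
    (suc C + suc (q + x)) + (suc (h + t) + suc (q + y)) + (R + (S + C)) + (2 + 2 * t)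
      ≡⟨ eq₁ h t C x y q R S ⟩
    4 + 2 * q + R + S + (h + t) + (2 * suc (t + C) + (x + y))
      ≡⟨ cong (4 + 2 * q + R + S + (h + t) +_) (cong₂ (λ z z′ → 2 * z + z′) tC xy) ⟩
    4 + 2 * q + R + S + (h + t) + (2 * h + (n + t))
      ≡⟨ eq₂ n t (4 + 2 * q + R + S) ⟩
    4 + 2 * q + R + S + (7 * n + 1) + (2 + 2 * t) ∎)
    where
    open ≡-Reasoning
    eq₁ : ∀ h t C x y q R S → (suc C + suc (q + x)) + (suc (h + t) + suc (q + y)) + (R + (S + C)) + (2 + 2 * t)
      ≡ 4 + 2 * q + R + S + (h + t) + (2 * suc (t + C) + (x + y))
    eq₁ = solve-∀
    eq₂ : ∀ n t X → X + (suc (n * 2) + t) + (2 * suc (n * 2) + (n + t)) ≡ X + (7 * n + 1) + (2 + 2 * t)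
    eq₂ = solve-∀

  zigzag<m : ∀ {t} → t < h → zigzag n t < m
  zigzag<m t<h = <-≤-trans (zigzag< n t<h) h≤m

  a-even : ∀ t → a (t * 2) ≡ zigzag n t
  a-even = byParity-even (zigzag n) (comp m ∘ zigzag n)

  a-odd : ∀ t → a (suc (t * 2)) ≡ comp m (zigzag n t)
  a-odd = byParity-odd (zigzag n) (comp m ∘ zigzag n)

  e-even : ∀ t → e (t * 2) ≡ comp h t
  e-even = byParity-even (comp h) (h +_)

  e-odd : ∀ t → e (suc (t * 2)) ≡ h + t
  e-odd = byParity-odd (comp h) (h +_)

  w-even : ∀ t → w (t * 2) ≡ h + t
  w-even = byParity-even (h +_) (comp h)

  w-odd : ∀ t → w (suc (t * 2)) ≡ comp h t
  w-odd = byParity-odd (h +_) (comp h)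

  -- Vertex `2 t` is preceded by `2 τ + 1` with `t` the successor of `τ` modulo `h`, so `Follows`
  -- treats the seam and the interior alike.
  uColor-even : ∀ {τ t} → τ < h → t < h → Follows h τ t → uColor (suc (τ * 2)) (t * 2) (suc (t * 2)) ≡ U₀
  uColor-even {τ} {t} τ<h t<h fol rewrite row-total (double-< t<h)
    | e-odd τ | a-odd τ | e-even t | a-odd t | w-even t =
    u-even-arith q R (s * m) (comp-+ (zigzag<m τ<h)) (comp-+ (zigzag<m t<h)) (comp-+ t<h) (zigzag-follows n fol)

  uColor-odd : ∀ {t u} → t < h → Follows h t u → uColor (t * 2) (suc (t * 2)) (u * 2) ≡ U₁
  uColor-odd {t} {u} t<h fol rewrite row-total (double-odd-< t<h)
    | e-even t | a-even t | e-odd t | a-even u | w-odd t =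
    u-odd-arith q R (s * m) (comp-+ t<h) (zigzag-follows n fol)

  -- Rows `2 t` and `2 t + 1` are taken together: their `a` codes are reflections in `m` and sum to
  -- `m - 1`, leaving only the pair sum `c` to depend on the column.
  column-total : ∀ j c → (∀ {t} → t < h → M (t * 2) j + M (suc (t * 2)) j ≡ c) →
    ∑< m (λ i → suc (m + k + M i j) + suc (q + a i)) ≡ h * (4 + 2 * (m + k) + 2 * q + suc (n * 2 * 2) + c)
  column-total j c pair = ∑<-pairs h (λ i → suc (m + k + M i j) + suc (q + a i)) λ {t} t<h → begin
    (suc (m + k + M (t * 2) j) + suc (q + a (t * 2))) + (suc (m + k + M (suc (t * 2)) j) + suc (q + a (suc (t * 2))))
      ≡⟨ eq (m + k) q (M (t * 2) j) (M (suc (t * 2)) j) (a (t * 2)) (a (suc (t * 2))) ⟩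
    4 + 2 * (m + k) + 2 * q + (a (t * 2) + a (suc (t * 2))) + (M (t * 2) j + M (suc (t * 2)) j)
      ≡⟨ cong₂ (λ x y → 4 + 2 * (m + k) + 2 * q + x + y) (a-pair t<h) (pair t<h) ⟩
    4 + 2 * (m + k) + 2 * q + suc (n * 2 * 2) + c ∎
    where
    open ≡-Reasoning
    eq : ∀ A q x y u v → (suc (A + x) + suc (q + u)) + (suc (A + y) + suc (q + v)) ≡ 4 + 2 * A + 2 * q + (u + v) + (x + y)
    eq = solve-∀
    a-pair : ∀ {t} → t < h → a (t * 2) + a (suc (t * 2)) ≡ suc (n * 2 * 2)
    a-pair {t} t<h rewrite a-even t | a-odd t = suc-injective (comp-+ (zigzag<m t<h))

  -- The two `w` codes sum to `m - 1`, and twice `s * m` brings this to `K - 1`.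
  column-last : ∀ {t} → t < h → M (t * 2) (s * 2) + M (suc (t * 2)) (s * 2) ≡ suc Q
  column-last {t} t<h rewrite M-last (t * 2) | M-last (suc (t * 2)) | w-even t | w-odd t =
    suc-injective (begin
      suc (s * m + (h + t) + (s * m + comp h t)) ≡⟨ eq (s * m) h t (comp h t) ⟩
      s * m + (s * m + (h + suc (t + comp h t))) ≡⟨ cong (λ z → s * m + (s * m + (h + z))) (comp-+ t<h) ⟩
      s * m + (s * m + (h + h))                  ≡⟨ cong (λ z → s * m + (s * m + z)) (double h) ⟩
      s * m + (s * m + m)                        ≡⟨ K-split ⟨
      K                                          ≡⟨ K≡ ⟩
      suc (suc Q) ∎)
    where
    open ≡-Reasoning
    eq : ∀ S h t C → suc (S + (h + t) + (S + C)) ≡ S + (S + (h + suc (t + C)))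
    eq = solve-∀

  -- The low entry is one less than the number whose reflection is added to it, so the sum falls one
  -- short of `K - 1`.
  column-even-pair : ∀ {r t} → r < s → t < h → M (t * 2) (r * 2) + M (suc (t * 2)) (r * 2) ≡ Q
  column-even-pair {r} {t} r<s t<h rewrite M-even-even t r<s | M-odd-even t r<s =
    suc-injective (suc-injective (begin
      suc (suc (r * m + t * 2 + comp K (r * m + suc (t * 2)))) ≡⟨ eq (r * m) (t * 2) (comp K (r * m + suc (t * 2))) ⟩
      suc (r * m + suc (t * 2) + comp K (r * m + suc (t * 2))) ≡⟨ comp-+ (entry<K (double-odd-< t<h) r<s) ⟩
      K ≡⟨ K≡ ⟩
      suc (suc Q) ∎))
    where
    open ≡-Reasoning
    eq : ∀ x y z → suc (suc (x + y + z)) ≡ suc (x + suc y + z)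
    eq = solve-∀

  -- Now the low entry is one more than the reflected number, so the sum exceeds `K - 1` by one.
  column-odd-pair : ∀ {r t} → r < s → t < h → M (t * 2) (suc (r * 2)) + M (suc (t * 2)) (suc (r * 2)) ≡ suc (suc Q)
  column-odd-pair {r} {t} r<s t<h rewrite M-even-odd t r<s | M-odd-odd t r<s = begin
      comp K (r * m + t * 2) + (r * m + suc (t * 2)) ≡⟨ eq (r * m) (t * 2) (comp K (r * m + t * 2)) ⟩
      suc (r * m + t * 2 + comp K (r * m + t * 2)) ≡⟨ comp-+ (entry<K (double-< t<h) r<s) ⟩
      K ≡⟨ K≡ ⟩
      suc (suc Q) ∎
    where
    open ≡-Reasoning
    eq : ∀ x y z → z + (x + suc y) ≡ suc (x + y + z)
    eq = solve-∀

  columnValue : ℕ → ℕ → ℕ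
  columnValue c d = h * (4 + 2 * (m + k) + 2 * q + suc (n * 2 * 2) + c) + (4 + 4 * m + 2 * q + d)

  -- The second argument is `4 s` plus the step of the zigzag from a vertex to its successor: `-s`
  -- from an even vertex, also across the seam, and `s + 1` from an odd one.
  V₀ V₁ V₂ : ℕ
  V₀ = columnValue (suc Q) (3 * s)
  V₁ = columnValue (suc (suc Q)) (5 * s + 1)
  V₂ = columnValue Q (3 * s)

  -- The predecessor's code `x` and the code `A` of the edge leaving it sum to `2 s`, so the
  -- predecessor drops out; the `vColor` lemmas therefore allow any `p`. What remains is the step
  -- from `y` to `z`.
  v-even-arith : ∀ {x y z A B} q m → suc (x + A) ≡ k → suc (y + B) ≡ k → y ≡ z + s →
    (suc (m + A) + suc (q + (m + x))) + (suc (m + B) + suc (q + (m + z))) ≡ 4 + 4 * m + 2 * q + 3 * s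
  v-even-arith {x} {z = z} {A} {B} q m xA yB refl = +-cancelʳ-≡ s _ _ (begin
    (suc (m + A) + suc (q + (m + x))) + (suc (m + B) + suc (q + (m + z))) + s ≡⟨ eq₁ s x z A B q m ⟩
    4 + 4 * m + 2 * q + ((x + A) + (z + s + B)) ≡⟨ cong₂ (λ u v → 4 + 4 * m + 2 * q + (u + v)) (suc-injective xA) (suc-injective yB) ⟩
    4 + 4 * m + 2 * q + (s * 2 + s * 2) ≡⟨ eq₂ s (4 + 4 * m + 2 * q) ⟩
    4 + 4 * m + 2 * q + 3 * s + s ∎)
    where
    open ≡-Reasoning
    eq₁ : ∀ s x z A B q m → (suc (m + A) + suc (q + (m + x))) + (suc (m + B) + suc (q + (m + z))) + s
      ≡ 4 + 4 * m + 2 * q + ((x + A) + (z + s + B))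
    eq₁ = solve-∀
    eq₂ : ∀ s X → X + (s * 2 + s * 2) ≡ X + 3 * s + s
    eq₂ = solve-∀

  v-odd-arith : ∀ {x y z A B} q m → suc (x + A) ≡ k → suc (y + B) ≡ k → z ≡ y + suc s →
    (suc (m + A) + suc (q + (m + x))) + (suc (m + B) + suc (q + (m + z))) ≡ 4 + 4 * m + 2 * q + (5 * s + 1)
  v-odd-arith {x} {y} {A = A} {B} q m xA yB refl = begin
    (suc (m + A) + suc (q + (m + x))) + (suc (m + B) + suc (q + (m + (y + suc s)))) ≡⟨ eq₁ s x y A B q m ⟩
    4 + 4 * m + 2 * q + ((x + A) + (y + B) + suc s) ≡⟨ cong₂ (λ u v → 4 + 4 * m + 2 * q + (u + v + suc s)) (suc-injective xA) (suc-injective yB) ⟩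
    4 + 4 * m + 2 * q + (s * 2 + s * 2 + suc s) ≡⟨ eq₂ s (4 + 4 * m + 2 * q) ⟩
    4 + 4 * m + 2 * q + (5 * s + 1) ∎
    where
    open ≡-Reasoning
    eq₁ : ∀ s x y A B q m → (suc (m + A) + suc (q + (m + x))) + (suc (m + B) + suc (q + (m + (y + suc s))))
      ≡ 4 + 4 * m + 2 * q + ((x + A) + (y + B) + suc s)
    eq₁ = solve-∀
    eq₂ : ∀ s X → X + (s * 2 + s * 2 + suc s) ≡ X + (5 * s + 1)
    eq₂ = solve-∀

  vColor-last : ∀ {p} → p < k → vColor p (s * 2) 0 ≡ V₀
  vColor-last p<k = cong₂ _+_ (column-total (s * 2) (suc Q) column-last)
    (v-even-arith q m (comp-+ (zigzag< s p<k)) (comp-+ (zigzag< s {s * 2} ≤-refl))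
      (trans (zigzag-even s s) (cong (_+ s) (sym (zigzag-even s 0 ⟨ trans ⟩ +-identityʳ s)))))

  vColor-even : ∀ {p r} → p < k → r < s → vColor p (r * 2) (suc (r * 2)) ≡ V₂
  vColor-even {p} {r} p<k r<s = cong₂ _+_ (column-total (r * 2) Q (column-even-pair r<s))
    (v-even-arith q m (comp-+ (zigzag< s p<k)) (comp-+ (zigzag< s {r * 2} (m<n⇒m<1+n (double-< r<s))))
      (trans (zigzag-even s r) (trans (+-comm s r) (cong (_+ s) (sym (zigzag-odd s r))))))

  vColor-odd : ∀ {p r} → p < k → r < s → vColor p (suc (r * 2)) (suc r * 2) ≡ V₁
  vColor-odd {p} {r} p<k r<s = cong₂ _+_ (column-total (suc (r * 2)) (suc (suc Q)) (column-odd-pair r<s))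
    (v-odd-arith q m (comp-+ (zigzag< s p<k)) (comp-+ (zigzag< s {suc (r * 2)} (m<n⇒m<1+n (double-odd-< r<s))))
      (trans (zigzag-even s (suc r)) (trans (+-comm s (suc r)) (trans (sym (+-suc r s)) (cong (_+ suc s) (sym (zigzag-odd s r)))))))

  U₁<U₀ : U₁ < U₀
  U₁<U₀ = +-monoʳ-< (4 + 2 * q + R + s * m) (<-≤-trans (≤-reflexive (eq₁ n)) (≤-trans (m≤m+n (7 * n + 2) (6 * n + 2)) (≤-reflexive (eq₂ n))))
    where
    eq₁ : ∀ n → suc (7 * n + 1) ≡ 7 * n + 2
    eq₁ = solve-∀
    eq₂ : ∀ n → 7 * n + 2 + (6 * n + 2) ≡ 13 * n + 4
    eq₂ = solve-∀

  columnValue-< : ∀ {c c′ d d′} → c < c′ → d ≤ d′ → columnValue c d < columnValue c′ d′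
  columnValue-< c<c′ d≤d′ = +-mono-<-≤
    (*-monoʳ-< h (+-monoʳ-< (4 + 2 * (m + k) + 2 * q + suc (n * 2 * 2)) c<c′)) (+-monoʳ-≤ (4 + 4 * m + 2 * q) d≤d′)

  V₂<V₀ : V₂ < V₀
  V₂<V₀ = columnValue-< ≤-refl ≤-refl

  V₀<V₁ : V₀ < V₁
  V₀<V₁ = columnValue-< ≤-refl (≤-trans (*-monoˡ-≤ s (≤ᵇ⇒≤ 3 5 _)) (m≤m+n (5 * s) 1))

-- Separating the colours of the two cycles

V₁<U₁ : ∀ n s → suc (n * 2) ≤ s → Colors.V₁ n s < Colors.U₁ n s
-- The dominant terms are `k q + s Q` for `C_m` against `2 h q + h Q` for `C_k`, so comparing `s`
-- with `h` decides. With `s = h + d` the difference becomes a polynomial with natural coefficients.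
V₁<U₁ n s h≤s with d , refl ← m≤n⇒∃[o]m+o≡n h≤s =
  subst (Colors.V₁ n s <_) (sym (eq n d)) (s≤s (m≤m+n _ _))
  where
  eq : ∀ n d →
    let s = suc (n * 2) + d ; h = suc (n * 2) ; m = h * 2 ; k = suc (s * 2) ; q = m + k + m * k
        Q = 4 * (n * 2 * s) + 2 * (n * 2) + 4 * s
        R = k * (2 + (m + k) + (q + m)) + s * suc Q + s * k in
    4 + 2 * q + R + s * m + (7 * n + 1)
    ≡ suc (h * (4 + 2 * (m + k) + 2 * q + suc (n * 2 * 2) + suc (suc Q)) + (4 + 4 * m + 2 * q + (5 * s + 1))
      + (47 * n + 13 + 55 * d + 40 * (n * n) + 120 * (n * d) + 48 * (n * n * d) + 22 * (d * d) + 24 * (n * d * d)))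
  eq = solve-∀

U₀<V₂ : ∀ n s → s ≤ n * 2 → Colors.U₀ n s < Colors.V₂ n s
U₀<V₂ n s s≤2n with d , s+d≡2n ← m≤n⇒∃[o]m+o≡n s≤2n = ≤-<-trans
  (+-monoʳ-≤ (4 + 2 * q + R + s * m) (≤-trans (m≤m+n (13 * n + 4) n) (≤-reflexive (eq₀ n))))
  (subst (λ D → U D < V D) s+d≡2n (subst (U (s + d) <_) (sym (eq s d)) (s≤s (m≤m+n _ _))))
  where
  open Codes n s
  open Colors n s
  U V : ℕ → ℕ
  -- U₀ with 13 n + 4 enlarged to 7 D + 4, where D = 2 n, so that n = (s + d) / 2
  -- need not be substituted.
  U D = let h = suc D ; m = h * 2 ; k = suc (s * 2) ; q = m + k + m * k
            Q = 4 * (D * s) + 2 * D + 4 * s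
            R = k * (2 + (m + k) + (q + m)) + s * suc Q + s * k in
        4 + 2 * q + R + s * m + (7 * D + 4)
  V D = let h = suc D ; m = h * 2 ; k = suc (s * 2) ; q = m + k + m * k
            Q = 4 * (D * s) + 2 * D + 4 * s in
        h * (4 + 2 * (m + k) + 2 * q + suc (D * 2) + Q) + (4 + 4 * m + 2 * q + 3 * s)
  eq₀ : ∀ n → 13 * n + 4 + n ≡ 7 * (n * 2) + 4
  eq₀ = solve-∀
  eq : ∀ s d →
    let D = s + d ; h = suc D ; m = h * 2 ; k = suc (s * 2) ; q = m + k + m * k
        Q = 4 * (D * s) + 2 * D + 4 * s
        R = k * (2 + (m + k) + (q + m)) + s * suc Q + s * k in
    h * (4 + 2 * (m + k) + 2 * q + suc (D * 2) + Q) + (4 + 4 * m + 2 * q + 3 * s)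
    ≡ suc (4 + 2 * q + R + s * m + (7 * D + 4)
      + (2 * (s * s) + 40 * (s * d) + 17 * s + 12 * (s * s * d) + 16 * (d * d) + 30 * d + 12 * (s * d * d) + 12))
  eq = solve-∀

-- From colour values to a proper colouring with five colours

onFin : ∀ {n} f → MapsBelow n n f → InjectiveBelow n f → Numbering (Fin n) n
onFin f f< f-inj = record
  { code      = f ∘ toℕ
  ; code<     = λ i → f< (toℕ<n i)
  ; injective = λ {i} {j} → toℕ-injective ∘ f-inj (toℕ<n i) (toℕ<n j)
  }

next-fromℕ< : ∀ {k i j} (i<k : i < k) (j<k : j < k) → Follows k i j → Next (fromℕ< i<k) (fromℕ< j<k)
next-fromℕ< i<k j<k = subst₂ (Follows _) (sym (toℕ-fromℕ< i<k)) (sym (toℕ-fromℕ< j<k))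

-- Collects what the case analysis needs of the colours and keeps the five values opaque, so that
-- their large polynomials stay folded.
record FiveColoring (n s′ : ℕ) (color : Fin (suc (n * 2) * 2 + suc (suc s′ * 2)) → ℕ) : Set where

  h : ℕ
  h = suc (n * 2)
  m : ℕ
  m = h * 2
  s : ℕ
  s = suc s′
  k : ℕ
  k = suc (s * 2)

  field
    uColor vColor : ℕ → ℕ → ℕ → ℕ
    U₀ U₁ V₀ V₁ V₂ : ℕ
    color-u-next : ∀ {p i x : Fin m} → Next p i → Next i x → color (i ↑ˡ k) ≡ uColor (toℕ p) (toℕ i) (toℕ x)
    color-v-next : ∀ {p j x : Fin k} → Next p j → Next j x → color (m ↑ʳ j) ≡ vColor (toℕ p) (toℕ j) (toℕ x)
    uColor-even : ∀ {τ t} → τ < h → t < h → Follows h τ t → uColor (suc (τ * 2)) (t * 2) (suc (t * 2)) ≡ U₀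
    uColor-odd : ∀ {t u} → t < h → Follows h t u → uColor (t * 2) (suc (t * 2)) (u * 2) ≡ U₁
    vColor-last : ∀ {p} → p < k → vColor p (s * 2) 0 ≡ V₀
    vColor-even : ∀ {p r} → p < k → r < s → vColor p (r * 2) (suc (r * 2)) ≡ V₂
    vColor-odd : ∀ {p r} → p < k → r < s → vColor p (suc (r * 2)) (suc r * 2) ≡ V₁
    U₁<U₀ : U₁ < U₀
    V₂<V₀ : V₂ < V₀
    V₀<V₁ : V₀ < V₁
    separated : U₀ < V₂ ⊎ V₁ < U₁

module Coloring {n s′ : ℕ} {color : Fin (suc (n * 2) * 2 + suc (suc s′ * 2)) → ℕ} (F : FiveColoring n s′ color) where

  open FiveColoring F

  color-u-at : ∀ p i x → p < m → (i<m : i < m) → x < m → Follows m p i → Follows m i x →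
    color (fromℕ< i<m ↑ˡ k) ≡ uColor p i x
  color-u-at p i x p<m i<m x<m p→i i→x =
    trans (color-u-next (next-fromℕ< p<m i<m p→i) (next-fromℕ< i<m x<m i→x)) (trans
      (cong₂ (λ y z → uColor y z (toℕ (fromℕ< x<m))) (toℕ-fromℕ< p<m) (toℕ-fromℕ< i<m))
      (cong (uColor p i) (toℕ-fromℕ< x<m)))

  color-v-at : ∀ p j x → p < k → (j<k : j < k) → x < k → Follows k p j → Follows k j x →
    color (m ↑ʳ fromℕ< j<k) ≡ vColor p j x
  color-v-at p j x p<k j<k x<k p→j j→x =
    trans (color-v-next (next-fromℕ< p<k j<k p→j) (next-fromℕ< j<k x<k j→x)) (trans
      (cong₂ (λ y z → vColor y z (toℕ (fromℕ< x<k))) (toℕ-fromℕ< p<k) (toℕ-fromℕ< j<k))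
      (cong (vColor p j) (toℕ-fromℕ< x<k)))

  uValue vValue : ℕ → ℕ
  uValue = byParity (λ _ → U₀) (λ _ → U₁)
  vValue j = atLast (s * 2) j V₀ (byParity (λ _ → V₂) (λ _ → V₁) j)

  uValue-even : ∀ t → uValue (t * 2) ≡ U₀
  uValue-even = byParity-even _ _

  uValue-odd : ∀ t → uValue (suc (t * 2)) ≡ U₁
  uValue-odd = byParity-odd _ _

  vValue-last : vValue (s * 2) ≡ V₀
  vValue-last = atLast-≡ (s * 2)

  vValue-even : ∀ {r} → r < s → vValue (r * 2) ≡ V₂
  vValue-even {r} r<s = trans (atLast-< (double-< r<s)) (byParity-even _ _ r)

  vValue-odd : ∀ {r} → r < s → vValue (suc (r * 2)) ≡ V₁
  vValue-odd {r} r<s = trans (atLast-< (double-odd-< r<s)) (byParity-odd _ _ r)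

  color-u-value : ∀ {i} (i<m : i < m) → color (fromℕ< i<m ↑ˡ k) ≡ uValue i
  color-u-value {i} i<m with evenOrOdd i
  -- The predecessor of vertex 0 is `m - 1`, the odd vertex with half-index `n * 2 = h - 1`.
  ... | even zero = trans
    (color-u-at (suc (n * 2 * 2)) 0 1 ≤-refl i<m (double-odd-< {p = h} z<s) (inj₂ (refl , refl)) (inj₁ refl))
    (uColor-even {n * 2} {0} ≤-refl z<s (inj₂ (refl , refl)))
  ... | even (suc t) = trans
    (color-u-at (suc (t * 2)) (suc t * 2) (suc (suc t * 2)) (<-trans ≤-refl i<m) i<m (double-odd-< t<h) (inj₁ refl) (inj₁ refl))
    (trans (uColor-even {t} {suc t} (<-trans ≤-refl t<h) t<h (inj₁ refl)) (sym (uValue-even (suc t))))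
    where
    t<h : suc t < h
    t<h = halve-< i<m
  ... | odd t with m≤n⇒m<n∨m≡n (s≤s⁻¹ (halve-odd-< {t} {h} i<m))
  ...   | inj₁ t<n*2 = trans
    (color-u-at (t * 2) (suc (t * 2)) (suc t * 2) (<-trans ≤-refl i<m) i<m (double-< (s<s t<n*2)) (inj₁ refl) (inj₁ refl))
    (trans (uColor-odd {t} {suc t} (<-trans t<n*2 ≤-refl) (inj₁ refl))
      (sym (uValue-odd t)))
  ...   | inj₂ refl = trans
    (color-u-at (n * 2 * 2) (suc (n * 2 * 2)) 0 (<-trans ≤-refl i<m) i<m z<s (inj₁ refl) (inj₂ (refl , refl)))
    (trans (uColor-odd {n * 2} {0} ≤-refl (inj₂ (refl , refl))) (sym (uValue-odd (n * 2))))

  color-v-value : ∀ {j} (j<k : j < k) → color (m ↑ʳ fromℕ< j<k) ≡ vValue j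
  color-v-value {j} j<k with evenOrOdd j
  ... | odd r = trans
    (color-v-at (r * 2) (suc (r * 2)) (suc r * 2) (<-trans ≤-refl j<k) j<k (s≤s (*-monoˡ-≤ 2 r<s)) (inj₁ refl) (inj₁ refl))
    (trans (vColor-odd {r * 2} {r} (<-trans ≤-refl j<k) r<s) (sym (vValue-odd r<s)))
    where
    r<s : r < s
    r<s = halve-< {r} {s} (s≤s⁻¹ j<k)
  ... | even zero = trans
    (color-v-at (s * 2) 0 1 ≤-refl j<k (s<s z<s) (inj₂ (refl , refl)) (inj₁ refl))
    (trans (vColor-even {s * 2} {0} ≤-refl z<s) (sym (vValue-even {0} z<s)))
  ... | even (suc r) with m≤n⇒m<n∨m≡n (halve-≤ {suc r} {s} j<k)
  ...   | inj₁ r<s = trans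
    (color-v-at (suc (r * 2)) (suc r * 2) (suc (suc r * 2)) (<-trans ≤-refl j<k) j<k (s≤s (double-< r<s)) (inj₁ refl) (inj₁ refl))
    (trans (vColor-even {suc (r * 2)} {suc r} (<-trans ≤-refl j<k) r<s) (sym (vValue-even r<s)))
  ...   | inj₂ refl = trans
    (color-v-at (suc (r * 2)) (s * 2) 0 (<-trans ≤-refl j<k) j<k z<s (inj₁ refl) (inj₂ (refl , refl)))
    (trans (vColor-last {suc (r * 2)} (<-trans ≤-refl j<k)) (sym vValue-last))

  color-↑ˡ : ∀ i → color (i ↑ˡ k) ≡ uValue (toℕ i)
  color-↑ˡ i = trans (cong (λ z → color (z ↑ˡ k)) (sym (fromℕ<-toℕ i (toℕ<n i)))) (color-u-value (toℕ<n i))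

  color-↑ʳ : ∀ j → color (m ↑ʳ j) ≡ vValue (toℕ j)
  color-↑ʳ j = trans (cong (λ z → color (m ↑ʳ z)) (sym (fromℕ<-toℕ j (toℕ<n j)))) (color-v-value (toℕ<n j))

  palette : List ℕ
  palette = U₀ ∷ U₁ ∷ V₂ ∷ V₁ ∷ V₀ ∷ []

  uValue-cases : ∀ i → uValue i ≡ U₀ ⊎ uValue i ≡ U₁
  uValue-cases i with evenOrOdd i
  ... | even t = inj₁ (uValue-even t)
  ... | odd t  = inj₂ (uValue-odd t)

  vValue-cases : ∀ {j} → j < k → vValue j ≡ V₂ ⊎ vValue j ≡ V₁ ⊎ vValue j ≡ V₀
  vValue-cases {j} j<k with evenOrOdd j
  ... | odd r = inj₂ (inj₁ (vValue-odd (halve-< {r} {s} (s≤s⁻¹ j<k))))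
  ... | even r with m≤n⇒m<n∨m≡n (halve-≤ {r} {s} j<k)
  ...   | inj₁ r<s  = inj₁ (vValue-even r<s)
  ...   | inj₂ refl = inj₂ (inj₂ vValue-last)

  color∈palette : ∀ x → color x ∈ palette
  color∈palette x with side m k x
  ... | left i  = subst (_∈ palette) (sym (color-↑ˡ i)) ([ here , there ∘ here ]′ (uValue-cases (toℕ i)))
  ... | right j = subst (_∈ palette) (sym (color-↑ʳ j))
    ([ there ∘ there ∘ here , [ there ∘ there ∘ there ∘ here , there ∘ there ∘ there ∘ there ∘ here ]′ ]′ (vValue-cases (toℕ<n j)))

  u-range : ∀ i → U₁ ≤ uValue i × uValue i ≤ U₀
  u-range i with uValue i | uValue-cases i
  ... | _ | inj₁ refl = <⇒≤ U₁<U₀ , ≤-refl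
  ... | _ | inj₂ refl = ≤-refl , <⇒≤ U₁<U₀

  v-range : ∀ {j} → j < k → V₂ ≤ vValue j × vValue j ≤ V₁
  v-range {j} j<k with vValue j | vValue-cases j<k
  ... | _ | inj₁ refl        = ≤-refl , <⇒≤ (<-trans V₂<V₀ V₀<V₁)
  ... | _ | inj₂ (inj₁ refl) = <⇒≤ (<-trans V₂<V₀ V₀<V₁) , ≤-refl
  ... | _ | inj₂ (inj₂ refl) = <⇒≤ V₂<V₀ , <⇒≤ V₀<V₁

  -- The colours of each cycle lie in an interval, and `separated` makes the two intervals disjoint.
  uValue≢vValue : ∀ i {j} → j < k → uValue i ≢ vValue j
  uValue≢vValue i {j} j<k eq with separated
  ... | inj₁ U₀<V₂ = <⇒≢ (≤-<-trans (proj₂ (u-range i)) (<-≤-trans U₀<V₂ (proj₁ (v-range j<k)))) eq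
  ... | inj₂ V₁<U₁ = <⇒≢ (≤-<-trans (proj₂ (v-range j<k)) (<-≤-trans V₁<U₁ (proj₁ (u-range i)))) (sym eq)

  uValue-proper : ∀ {i x} → Follows m i x → uValue i ≢ uValue x
  uValue-proper {i} (inj₁ refl) with evenOrOdd i
  ... | even t = λ eq → <⇒≢ U₁<U₀ (sym (trans (sym (uValue-even t)) (trans eq (uValue-odd t))))
  ... | odd t  = λ eq → <⇒≢ U₁<U₀ (trans (sym (uValue-odd t)) (trans eq (uValue-even (suc t))))
  uValue-proper (inj₂ (refl , refl)) eq = <⇒≢ U₁<U₀ (trans (sym (uValue-odd (n * 2))) eq)

  V₂<V₁ : V₂ < V₁
  V₂<V₁ = <-trans V₂<V₀ V₀<V₁

  -- Around the odd cycle the colours run `V₂`, `V₁`, repeated, and end with a single `V₀`, which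
  -- lies strictly between the other two and so differs from both neighbours.
  vValue-proper : ∀ {j x} → x < k → Follows k j x → vValue j ≢ vValue x
  vValue-proper _ (inj₂ (refl , refl)) eq = <⇒≢ V₂<V₀ (sym (trans (sym vValue-last) (trans eq (vValue-even {0} z<s))))
  vValue-proper {j} x<k (inj₁ refl) with evenOrOdd j
  ... | even r = λ eq → <⇒≢ V₂<V₁ (trans (sym (vValue-even r<s)) (trans eq (vValue-odd r<s)))
    where
    r<s : r < s
    r<s = halve-< {r} {s} (s≤s⁻¹ x<k)
  ... | odd r with m≤n⇒m<n∨m≡n (halve-≤ {suc r} {s} x<k)
  ...   | inj₁ r<s  = λ eq → <⇒≢ V₂<V₁ (sym (trans (sym (vValue-odd (<-trans ≤-refl r<s))) (trans eq (vValue-even r<s))))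
  ...   | inj₂ refl = λ eq → <⇒≢ V₀<V₁ (sym (trans (sym (vValue-odd {r} ≤-refl)) (trans eq vValue-last)))

  module _ (3≤m : 3 ≤ m) (3≤k : 3 ≤ k) where

    private
      J = cycle m 3≤m ∨ cycle k 3≤k

    proper : ∀ {u v} → Side m k u → Side m k v → Adj J u v → color u ≢ color v
    proper (left i) (left x) adj eq = [ (λ i→x → uValue-proper i→x eq′) , (λ x→i → uValue-proper x→i (sym eq′)) ]′
        (adjˡˡ⁻¹ (cycle m 3≤m) (cycle k 3≤k) {i} {x} adj)
      where
      eq′ = trans (sym (color-↑ˡ i)) (trans eq (color-↑ˡ x))
    proper (right j) (right x) adj eq = [ (λ j→x → vValue-proper (toℕ<n x) j→x eq′) , (λ x→j → vValue-proper (toℕ<n j) x→j (sym eq′)) ]′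
        (adjʳʳ⁻¹ (cycle m 3≤m) (cycle k 3≤k) {j} {x} adj)
      where
      eq′ = trans (sym (color-↑ʳ j)) (trans eq (color-↑ʳ x))
    proper (left i) (right j) _ eq =
      uValue≢vValue (toℕ i) (toℕ<n j) (trans (sym (color-↑ˡ i)) (trans eq (color-↑ʳ j)))
    proper (right j) (left i) _ eq =
      uValue≢vValue (toℕ i) (toℕ<n j) (sym (trans (sym (color-↑ʳ j)) (trans eq (color-↑ˡ i))))

-- Assembling the labeling and the theorem

module Solution (n s′ : ℕ) (3≤m : 3 ≤ suc (n * 2) * 2) (3≤k : 3 ≤ suc (suc s′ * 2)) where

  s : ℕ
  s = suc s′

  open Codes n s
  open Colors n s

  J : Graph
  J = cycle m 3≤m ∨ cycle k 3≤k

  cellNumbering : Numbering (Fin m × Fin k) (m * k)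
  cellNumbering = record
    { code      = λ (i , j) → M (toℕ i) (toℕ j)
    ; code<     = λ (i , j) → cell<K (toℕ<n i) (cell (toℕ i) (toℕ<n j))
    ; injective = λ {(i , j)} {(i′ , j′)} eq →
        let i≡ , j≡ = cell-unique (toℕ<n i) (toℕ<n i′) (cell (toℕ i) (toℕ<n j)) (cell (toℕ i′) (toℕ<n j′)) eq
        in cong₂ _,_ (toℕ-injective i≡) (toℕ-injective j≡)
    }

  aNumbering eNumbering : Numbering (Fin m) m
  aNumbering = onFin a a< a-injective
  eNumbering = onFin e e< e-injective

  bNumbering gNumbering : Numbering (Fin k) k
  bNumbering = onFin b b< (zigzag-injective s)
  gNumbering = onFin g g< g-injective

  f : TotalLabeling J
  f = labeling 3≤m 3≤k aNumbering eNumbering bNumbering gNumbering cellNumbering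

  color : Vertex J → ℕ
  color = inducedColor {J} f

  private
    color-u-next : ∀ {p i x : Fin m} → Next p i → Next i x → color (i ↑ˡ k) ≡ uColor (toℕ p) (toℕ i) (toℕ x)
    color-u-next = color-u≡ 3≤m 3≤k aNumbering eNumbering bNumbering gNumbering cellNumbering

    color-v-next : ∀ {p j x : Fin k} → Next p j → Next j x → color (m ↑ʳ j) ≡ vColor (toℕ p) (toℕ j) (toℕ x)
    color-v-next = color-v≡ 3≤m 3≤k aNumbering eNumbering bNumbering gNumbering cellNumbering

  fiveColoring : FiveColoring n s′ color
  fiveColoring = record
    { uColor = uColor
    ; vColor = vColor
    ; U₀ = U₀
    ; U₁ = U₁
    ; V₀ = V₀
    ; V₁ = V₁
    ; V₂ = V₂
    ; color-u-next = color-u-next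
    ; color-v-next = color-v-next
    ; uColor-even = uColor-even
    ; uColor-odd = uColor-odd
    ; vColor-last = vColor-last
    ; vColor-even = vColor-even
    ; vColor-odd = vColor-odd
    ; U₁<U₀ = U₁<U₀
    ; V₂<V₀ = V₂<V₀
    ; V₀<V₁ = V₀<V₁
    -- Since `h` is `suc (n * 2)`, this decides between `s < h` and `h ≤ s`.
    ; separated = Sum.map (U₀<V₂ n s) (V₁<U₁ n s) (≤-<-connex s (n * 2))
    }

  f-proper : IsLocalTotalNeighborhoodAntimagic {J} f
  f-proper u v = Coloring.proper fiveColoring 3≤m 3≤k (side m k u) (side m k v)

  ≥5 : ∀ f → IsLocalTotalNeighborhoodAntimagic {J} f → 5 ≤ numberOfColors {J} f
  ≥5 = numberOfColors≥5 {n * 2 * 2} {s′} 3≤m 3≤k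

  χltna≡5 : χltna J is 5
  χltna≡5 = record
    { noIsolated = join-noIsolated (cycle m 3≤m) (cycle k 3≤k) Fin.zero Fin.zero
    ; attained   = f , f-proper , ≤-antisym
        (numberOfColors-≤ {J} f {Coloring.palette fiveColoring} (Coloring.color∈palette fiveColoring))
        (≥5 f f-proper)
    ; minimal    = ≥5
    }

cycle-cong : ∀ {k k′} (3≤k : 3 ≤ k) (3≤k′ : 3 ≤ k′) → k ≡ k′ → cycle k 3≤k ≡ cycle k′ 3≤k′
cycle-cong {k} p p′ refl = cong (cycle k) (≤-irrelevant p p′)

theorem2p9 : (n s : ℕ) (1≤n : 1 ≤ n) (1≤s : 1 ≤ s) →
    χltna (cycle (4 * n + 2) (3≤4n+2 1≤n) ∨ cycle (2 * s + 1) (3≤2s+1 1≤s)) is 5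
-- The construction has the lengths `suc (n * 2) * 2` and `suc (suc s * 2)`, suited to recursion by
-- parity; they are carried over to the stated lengths.
theorem2p9 n (suc s) 1≤n 1≤s = subst₂ (λ C D → χltna (C ∨ D) is 5)
  (cycle-cong 3≤m (3≤4n+2 1≤n) m≡) (cycle-cong 3≤k (3≤2s+1 1≤s) k≡)
  (Solution.χltna≡5 n s 3≤m 3≤k)
  where
  m≡ : suc (n * 2) * 2 ≡ 4 * n + 2
  m≡ = eq n
    where
    eq : ∀ n → suc (n * 2) * 2 ≡ 4 * n + 2
    eq = solve-∀
  k≡ : suc (suc s * 2) ≡ 2 * suc s + 1
  k≡ = eq (suc s)
    where
    eq : ∀ s → suc (s * 2) ≡ 2 * s + 1
    eq = solve-∀
  3≤m = subst (3 ≤_) (sym m≡) (3≤4n+2 1≤n)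
  3≤k = subst (3 ≤_) (sym k≡) (3≤2s+1 1≤s)
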